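{- For a squarefree integer $D$ and a positive integer $d$, let $\mathcal{AP}_{(1,1,1,d)}(\mathbb{Q}(\sqrt{D}))$ be the set of triples $(x,y,z)$ of elements of the ring of integers of $\mathbb{Q}(\sqrt{D})$ with $y-x=z-y$ satisfying $x^2+y^2+z^2=dxyz$, and let $\mathcal{AP}_{(1,1,1,d)}(\mathbb{Q})$ be the analogous set of integer triples. Let $i=\sqrt{ -1}$. Then: $\mathcal{AP}_{(1,1,1,1)}(\mathbb{Q}(i))=\{(0,0,0),(3,3,3),(-15,-6,3),(3,-6,-15),(2,\pm2i+2,\pm4i+2),(\pm i+2,2,\mp i+2),(\pm i+2,\pm2i-1,\pm3i-4),(\pm2i-1,-1,\mp2i-1),(\pm4i+2,\pm2i+2,2),(\pm3i-4,\pm2i-1,\pm i+2)\}$ (signs taken consistently within each triple); $\mathcal{AP}_{(1,1,1,2)}(\mathbb{Q}(i))=\{(0,0,0),(\pm2i+1,\pm i+1,1),(1,\pm i+1,\pm2i+1)\}$; and for every squarefree $D<0$ and positive integer $d$ with $(D,d)\neq(-1,1),(-1,2)$, $\mathcal{AP}_{(1,1,1,d)}(\mathbb{Q}(\sqrt{D}))=\mathcal{AP}_{(1,1,1,d)}(\mathbb{Q})$. -}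

module Defs where

open import Data.Nat as ℕ using (ℕ; zero; suc)
open import Data.Integer using (ℤ; +_; -_; _+_; _-_; _*_; ∣_∣)
open import Data.Integer.DivMod using (_/ℕ_; _%ℕ_)
open import Data.Nat.Divisibility using (_∣_)
open import Data.Product using (_×_; _,_; ∃)
open import Relation.Binary.PropositionalEquality using (_≡_)

Squarefree : ℤ → Set
Squarefree D = ∀ (n : ℕ) → (n ℕ.* n) ∣ ∣ D ∣ → n ≡ 1

-- The ring of integers O_D of Q(√D) (D squarefree, D ≠ 0,1) is Z[ω] with
--   ω = (1+√D)/2  if D ≡ 1 (mod 4),   ω = √D otherwise.
-- An element a + bω is represented by the pair (a , b) ∈ ℤ × ℤ (unique rep.).
-- ω² = p + q ω where (p , q) = ωSq D:
--   D ≡ 1 mod 4 : ω² = ω + (D-1)/4 ;  otherwise ω² = D.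
ωSq : ℤ → ℤ × ℤ
ωSq D with D %ℕ 4
... | 1 = ((D - + 1) /ℕ 4 , + 1)
... | _ = (D , + 0)

O : ℤ → Set
O D = ℤ × ℤ

ι : (D : ℤ) → ℤ → O D
ι D a = (a , + 0)

addO : (D : ℤ) → O D → O D → O D
addO D (a , b) (c , e) = (a + c , b + e)

subO : (D : ℤ) → O D → O D → O D
subO D (a , b) (c , e) = (a - c , b - e)

-- (a + bω)(c + eω) = ac + (ae + bc)ω + be(p + qω)
mulO : (D : ℤ) → O D → O D → O D
mulO D (a , b) (c , e) with ωSq D
... | (p , q) = (a * c + b * e * p , a * e + b * c + b * e * q)

APK : (D : ℤ) (d : ℕ) → O D → O D → O D → Set
APK D d x y z =
  (subO D y x ≡ subO D z y) ×
  (addO D (addO D (mulO D x x) (mulO D y y)) (mulO D z z)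
     ≡ mulO D (mulO D (mulO D (ι D (+ d)) x) y) z)

APℚ : (d : ℕ) → ℤ → ℤ → ℤ → Set
APℚ d a b c = (b - a ≡ c - b) × (a * a + b * b + c * c ≡ + d * a * b * c)

-- Gaussian integer a + b i (D = -1, ω = i), written  g a b
g : ℤ → ℤ → O (- + 1)
g a b = (a , b)

-- Write the progression as (y − e , y , y + e) and put t = d y.  The equation becomes
-- e² (t + 2) = y² (t − 3), so for y ≠ 0 the element w = e (t + 2) / y satisfies
-- w² = (t − 3)(t + 2).  It is an algebraic integer, hence lies in ℤ[ω] (here D squarefree is used), and
--   (2 (t − w) − 1) (2 (t + w) − 1) = 25.
-- The two norms are positive integers with product 625, so after replacing e by − e the first is at
-- most 25.  An element 2 u − 1 has norm A² + |disc| B², which leaves finitely many u = t − w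
-- and discriminants; the other factor is 25 times the conjugate of the first over its norm, and t, w, y, e follow.
module Submission where

open import Defs
open import Algebra.Bundles using (CommutativeRing; RawRing)
open import Algebra.Properties.Ring using (-‿distribˡ-*)
open import Algebra.Solver.Ring.AlmostCommutativeRing
  using (fromCommutativeRing; _-Raw-AlmostCommutative⟶_)
open import Data.Empty using (⊥; ⊥-elim)
open import Data.Fin using (Fin; toℕ; fromℕ<)
import Data.Fin.Properties as Fin
open import Data.Integer
  using (ℤ; +_; -[1+_]; -_; _+_; _-_; _*_; ∣_∣; NonZero; ≢-nonZero; _<_; -<+)
import Data.Integer.Properties as ℤ
open import Data.Integer.DivMod using (_%ℕ_; _/ℕ_; a≡a%ℕn+[a/ℕn]*n; n%ℕd<d)
open import Data.Integer.Divisibility.Signed using (_∣_; divides; _∣?_; ∣⇒∣ᵤ; ∣ᵤ⇒∣)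
open import Data.Integer.Tactic.RingSolver using (solve-∀)
open import Data.List using (List; []; _∷_)
open import Data.List.Membership.Propositional using (_∈_)
import Data.List.Membership.DecPropositional as DecMembership
open import Data.List.Relation.Unary.All using (All; all?; lookup)
open import Data.List.Relation.Unary.Any using (here; there)
open import Data.List.Relation.Unary.Any.Properties using (¬Any[])
import Data.Maybe as Maybe
open import Data.Maybe using (Maybe)
open import Data.Nat as ℕ using (ℕ; suc; _≤_)
import Data.Nat.Properties as ℕ
import Data.Nat.Divisibility as ℕ
open import Data.Nat.Coprimality using (Coprime; coprime-divisor)
import Data.Nat.Coprimality as Coprimality
open import Data.Nat.GCD using (gcd; gcd[m,n]∣m; gcd[m,n]∣n; gcd[m,n]≢0; gcd-greatest)
open import Data.Product using (_×_; _,_; proj₁; proj₂; ∃-syntax)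
open import Data.Product.Properties using (≡-dec)
open import Data.Sum using (_⊎_; inj₁; inj₂)
open import Function.Bundles using (_⇔_; mk⇔)
open import Level using (0ℓ)
open import Relation.Binary.PropositionalEquality
  using (_≡_; _≢_; refl; sym; trans; cong; cong₂; subst; subst₂; isEquivalence; module ≡-Reasoning)
open import Relation.Nullary using (¬_; Dec; yes; no; contradiction)
open import Relation.Nullary.Decidable
  using (False; toWitnessFalse; from-yes; dec⇒maybe; _→-dec_; _×-dec_)

-- The constant 25 comes from completing the square: w² = (t - 3)(t + 2) says (2 t - 1)² - (2 w)² =
-- 25, and 25 is the discriminant of X² - X - 6. Integrality of w needs care because only divisions
-- by integers are available. Multiplying by the conjugate of y writes w as an element of ℤ[ω] over
-- the integer N(y). Its trace and norm are then shown to be integers, and comparing discriminants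
-- with a squarefree D puts both coordinates in ℤ. The pairs (t , w) alone do not give the theorem:
-- square roots also exist in ℚ(√-6), and Gaussian ones exist independently of d. They are discarded
-- on the way back, where d must divide t and t + 2 must divide w y. Over ℚ(√-6) this would make 3
-- divide 1, and a Gaussian t with d ∣ t forces d ∣ 2, which is where the two exceptional pairs (D ,
-- d) come from. The value t = -2 is excluded separately, since there e is not determined by w y = e
-- (t + 2).

ℤ-rawRing : RawRing 0ℓ 0ℓ
ℤ-rawRing = CommutativeRing.rawRing ℤ.+-*-commutativeRing

-- Polynomial identities over a commutative ring

module Identities (R : CommutativeRing 0ℓ 0ℓ)
  (hom : ℤ-rawRing -Raw-AlmostCommutative⟶ fromCommutativeRing R) where

  open CommutativeRing R
    renaming (_+_ to _⊕_; _*_ to _·_; -_ to ⊝_; _-_ to _⊖_; refl to ≈-refl; trans to ≈-trans; isEquivalence to ≈-isEquivalence; sym to ≈-sym)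
  open _-Raw-AlmostCommutative⟶_ hom using (⟦_⟧)

  coefficient-≟ : ∀ a b → Maybe (⟦ a ⟧ ≈ ⟦ b ⟧)
  coefficient-≟ a b = Maybe.map (λ { refl → ≈-refl }) (dec⇒maybe (a ℤ.≟ b))

  open import Algebra.Solver.Ring ℤ-rawRing (fromCommutativeRing R) hom coefficient-≟
    using (solve; _:=_; _:+_; _:*_; _:-_; con)
  open import Relation.Binary.Reasoning.Setoid setoid

  -- Turns a goal that depends on a hypothesis into an unconditional polynomial identity, which the
  -- ring solver can check.
  shift : ∀ {a b c d} → c ≈ d → a ≈ b ⊕ (c ⊖ d) → a ≈ b
  shift {a} {b} {c} {d} c≈d eq = begin
    a            ≈⟨ eq ⟩
    b ⊕ (c ⊖ d)  ≈⟨ +-congˡ (≈-trans (+-congʳ c≈d) (-‿inverseʳ d)) ⟩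
    b ⊕ 0#       ≈⟨ +-identityʳ b ⟩
    b            ∎

  progression : ∀ δ y e →
    (y ⊖ e) · (y ⊖ e) ⊕ y · y ⊕ (y ⊕ e) · (y ⊕ e) ≈ δ · (y ⊖ e) · y · (y ⊕ e) →
    e · e · (δ · y ⊕ ⟦ + 2 ⟧) ≈ y · y · (δ · y ⊕ ⟦ - + 3 ⟧)
  progression δ y e h = shift h (solve 3 (λ δ y e →
    e :* e :* (δ :* y :+ con (+ 2)) :=
    y :* y :* (δ :* y :+ con (- + 3)) :+
      ((y :- e) :* (y :- e) :+ y :* y :+ (y :+ e) :* (y :+ e) :- δ :* (y :- e) :* y :* (y :+ e)))
    ≈-refl δ y e)

  -- Meant for `c = conj y`: then `y · c` is an integer, and `e · s · c` over that integer is e s /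
  -- y.
  square-of-root : ∀ e y c r s → e · e · s ≈ y · y · r →
    (e · s · c) · (e · s · c) ≈ (y · c) · (y · c) · (r · s)
  square-of-root e y c r s h = begin
    (e · s · c) · (e · s · c)    ≈⟨ solve 3 (λ e c s → (e :* s :* c) :* (e :* s :* c) := (e :* e :* s) :* (c :* c :* s)) ≈-refl e c s ⟩
    (e · e · s) · (c · c · s)    ≈⟨ *-congʳ h ⟩
    (y · y · r) · (c · c · s)    ≈⟨ solve 4 (λ y c r s → (y :* y :* r) :* (c :* c :* s) := (y :* c) :* (y :* c) :* (r :* s)) ≈-refl y c r s ⟩
    (y · c) · (y · c) · (r · s)  ∎

  -- A difference of two squares: 4 (t - 3)(t + 2) = (2 t - 1)² - 25, which is why the hypothesis
  -- enters with the factor -4.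
  factorisation : ∀ t w → w · w ≈ (t ⊕ ⟦ - + 3 ⟧) · (t ⊕ ⟦ + 2 ⟧) →
    (⟦ + 2 ⟧ · (t ⊖ w) ⊕ ⟦ - + 1 ⟧) · (⟦ + 2 ⟧ · (t ⊕ w) ⊕ ⟦ - + 1 ⟧) ≈ ⟦ + 25 ⟧
  factorisation t w h = shift (*-congˡ {⟦ - + 4 ⟧} h) (solve 2 (λ t w →
    (con (+ 2) :* (t :- w) :+ con (- + 1)) :* (con (+ 2) :* (t :+ w) :+ con (- + 1)) :=
    con (+ 25) :+ (con (- + 4) :* (w :* w) :- con (- + 4) :* ((t :+ con (- + 3)) :* (t :+ con (+ 2)))))
    ≈-refl t w)

-- The quadratic order with ω² = p + q ω: ring structure, conjugation, norm

module Order (p q : ℤ) where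

  infixl 7 _·_
  infixl 6 _⊕_ _⊖_

  _⊕_ _⊖_ _·_ : ℤ × ℤ → ℤ × ℤ → ℤ × ℤ
  (a , b) ⊕ (c , e) = a + c , b + e
  (a , b) ⊖ (c , e) = a - c , b - e
  (a , b) · (c , e) = a * c + b * e * p , a * e + b * c + b * e * q

  ⊝_ : ℤ × ℤ → ℤ × ℤ
  ⊝ (a , b) = - a , - b

  int : ℤ → ℤ × ℤ
  int a = a , + 0

  commutativeRing : CommutativeRing 0ℓ 0ℓ
  commutativeRing = record
    { Carrier = ℤ × ℤ ; _≈_ = _≡_ ; _+_ = _⊕_ ; _*_ = _·_ ; -_ = ⊝_ ; 0# = int (+ 0) ; 1# = int (+ 1)
    ; isCommutativeRing = record
      { isRing = record
        { +-isAbelianGroup = record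
          { isGroup = record
            { isMonoid = record
              { isSemigroup = record
                { isMagma = record { isEquivalence = isEquivalence ; ∙-cong = cong₂ _⊕_ }
                ; assoc = λ x y z → cong₂ _,_ (ℤ.+-assoc (proj₁ x) _ _) (ℤ.+-assoc (proj₂ x) _ _) }
              ; identity = (λ x → cong₂ _,_ (ℤ.+-identityˡ _) (ℤ.+-identityˡ _))
                         , (λ x → cong₂ _,_ (ℤ.+-identityʳ _) (ℤ.+-identityʳ _)) }
            ; inverse = (λ x → cong₂ _,_ (ℤ.+-inverseˡ (proj₁ x)) (ℤ.+-inverseˡ (proj₂ x)))
                      , (λ x → cong₂ _,_ (ℤ.+-inverseʳ (proj₁ x)) (ℤ.+-inverseʳ (proj₂ x)))
            ; ⁻¹-cong = cong ⊝_ }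
          ; comm = λ x y → cong₂ _,_ (ℤ.+-comm (proj₁ x) _) (ℤ.+-comm (proj₂ x) _) }
        ; *-cong = cong₂ _·_
        ; *-assoc = λ (a , b) (c , d) (e , f) → cong₂ _,_ (assoc₁ a b c d e f p q) (assoc₂ a b c d e f p q)
        ; *-identity = (λ (a , b) → cong₂ _,_ (idˡ₁ a b p) (idˡ₂ a b q))
                     , (λ (a , b) → cong₂ _,_ (idʳ₁ a b p) (idʳ₂ a b q))
        ; distrib = (λ (a , b) (c , d) (e , f) → cong₂ _,_ (distˡ₁ a b c d e f p) (distˡ₂ a b c d e f q))
                  , (λ (a , b) (c , d) (e , f) → cong₂ _,_ (distʳ₁ a b c d e f p) (distʳ₂ a b c d e f q)) }
      ; *-comm = λ (a , b) (c , d) → cong₂ _,_ (comm₁ a b c d p) (comm₂ a b c d q) } }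
    where
    assoc₁ : ∀ a b c d e f p q → (a * c + b * d * p) * e + (a * d + b * c + b * d * q) * f * p
           ≡ a * (c * e + d * f * p) + b * (c * f + d * e + d * f * q) * p
    assoc₁ = solve-∀
    assoc₂ : ∀ a b c d e f p q →
      (a * c + b * d * p) * f + (a * d + b * c + b * d * q) * e + (a * d + b * c + b * d * q) * f * q
      ≡ a * (c * f + d * e + d * f * q) + b * (c * e + d * f * p) + b * (c * f + d * e + d * f * q) * q
    assoc₂ = solve-∀
    idˡ₁ : ∀ a b p → + 1 * a + + 0 * b * p ≡ a
    idˡ₁ = solve-∀
    idˡ₂ : ∀ a b q → + 1 * b + + 0 * a + + 0 * b * q ≡ b
    idˡ₂ = solve-∀
    idʳ₁ : ∀ a b p → a * + 1 + b * + 0 * p ≡ a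
    idʳ₁ = solve-∀
    idʳ₂ : ∀ a b q → a * + 0 + b * + 1 + b * + 0 * q ≡ b
    idʳ₂ = solve-∀
    distˡ₁ : ∀ a b c d e f p → a * (c + e) + b * (d + f) * p ≡ (a * c + b * d * p) + (a * e + b * f * p)
    distˡ₁ = solve-∀
    distˡ₂ : ∀ a b c d e f q → a * (d + f) + b * (c + e) + b * (d + f) * q
           ≡ (a * d + b * c + b * d * q) + (a * f + b * e + b * f * q)
    distˡ₂ = solve-∀
    distʳ₁ : ∀ a b c d e f p → (c + e) * a + (d + f) * b * p ≡ (c * a + d * b * p) + (e * a + f * b * p)
    distʳ₁ = solve-∀
    distʳ₂ : ∀ a b c d e f q → (c + e) * b + (d + f) * a + (d + f) * b * q
           ≡ (c * b + d * a + d * b * q) + (e * b + f * a + f * b * q)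
    distʳ₂ = solve-∀
    comm₁ : ∀ a b c d p → a * c + b * d * p ≡ c * a + d * b * p
    comm₁ = solve-∀
    comm₂ : ∀ a b c d q → a * d + b * c + b * d * q ≡ c * b + d * a + d * b * q
    comm₂ = solve-∀

  open CommutativeRing commutativeRing public using (ring; *-assoc; *-comm)

  int-hom : ℤ-rawRing -Raw-AlmostCommutative⟶ fromCommutativeRing commutativeRing
  int-hom = record
    { ⟦_⟧ = int ; +-homo = λ _ _ → refl ; *-homo = λ a b → cong₂ _,_ (hom₁ a b p) (hom₂ a b q)
    ; -‿homo = λ _ → refl ; 0-homo = refl ; 1-homo = refl }
    where
    hom₁ : ∀ a b p → a * b ≡ a * b + + 0 * + 0 * p
    hom₁ = solve-∀
    hom₂ : ∀ a b q → + 0 ≡ a * + 0 + + 0 * b + + 0 * + 0 * q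
    hom₂ = solve-∀

  open Identities commutativeRing int-hom public using (progression; square-of-root; factorisation)

  -- The two roots of X² - q X - p add up to q, so ω is conjugate to q - ω.
  conj : ℤ × ℤ → ℤ × ℤ
  conj (a , b) = a + b * q , - b

  norm : ℤ × ℤ → ℤ
  norm (a , b) = a * a + a * b * q - b * b * p

  norm-· : ∀ x y → norm (x · y) ≡ norm x * norm y
  norm-· (a , b) (c , d) = lemma a b c d p q
    where
    lemma : ∀ a b c d p q →
      (a * c + b * d * p) * (a * c + b * d * p)
        + (a * c + b * d * p) * (a * d + b * c + b * d * q) * q
        - (a * d + b * c + b * d * q) * (a * d + b * c + b * d * q) * p
      ≡ (a * a + a * b * q - b * b * p) * (c * c + c * d * q - d * d * p)
    lemma = solve-∀

  ·-conj : ∀ x → x · conj x ≡ int (norm x)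
  ·-conj (a , b) = cong₂ _,_ (lemma₁ a b p q) (lemma₂ a b q)
    where
    lemma₁ : ∀ a b p q → a * (a + b * q) + b * (- b) * p ≡ a * a + a * b * q - b * b * p
    lemma₁ = solve-∀
    lemma₂ : ∀ a b q → a * (- b) + b * (a + b * q) + b * (- b) * q ≡ + 0
    lemma₂ = solve-∀

  int-· : ∀ k a b → int k · (a , b) ≡ (k * a , k * b)
  int-· k a b = cong₂ _,_ (ℤ.+-identityʳ (k * a)) (trans (ℤ.+-identityʳ _) (ℤ.+-identityʳ (k * b)))

  int-·-≡ : ∀ k x {y} → int k · x ≡ y → (k * proj₁ x , k * proj₂ x) ≡ y
  int-·-≡ k x eq = trans (sym (int-· k (proj₁ x) (proj₂ x))) eq

  int-·-int : ∀ a b → int a · int b ≡ int (a * b)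
  int-·-int a b = trans (int-· a b (+ 0)) (cong (a * b ,_) (ℤ.*-zeroʳ a))

-- Divisibility by squares

coprime-* : ∀ {a b c} → Coprime a c → Coprime b c → Coprime (a ℕ.* b) c
coprime-* ac bc (d∣ab , d∣c) =
  bc (coprime-divisor (λ (e∣d , e∣a) → ac (e∣a , ℕ.∣-trans e∣d d∣c)) d∣ab , d∣c)

-- After division by `g = gcd k b` the quotients k′ and b′ are coprime, so k′² must divide `D`
-- itself. Squarefreeness gives k′ = 1, that is, k is the gcd.
squarefree-cancelℕ : ∀ D k b .{{_ : ℕ.NonZero k}} → (∀ n → n ℕ.* n ℕ.∣ D → n ≡ 1) →
  k ℕ.* k ℕ.∣ D ℕ.* (b ℕ.* b) → k ℕ.∣ b
squarefree-cancelℕ D k b squarefree kk∣Dbb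
  with gcd k b in g-eq | gcd[m,n]∣m k b | gcd[m,n]∣n k b
     | ℕ.≢-nonZero (gcd[m,n]≢0 k b (inj₁ (ℕ.≢-nonZero⁻¹ k)))
... | g | ℕ.divides k′ refl | ℕ.divides b′ refl | g≢0 =
  subst (λ u → u ℕ.* g ℕ.∣ b′ ℕ.* g) (sym k′≡1) (ℕ.*-monoˡ-∣ g (ℕ.1∣ b′))
  where
  instance _ = g≢0
  instance _ = ℕ.m*n≢0 g g
  coprime : Coprime k′ b′
  coprime {d} (ℕ.divides u refl , ℕ.divides v refl) = ℕ.∣1⇒≡1 (ℕ.*-cancelʳ-∣ g
    (subst (d ℕ.* g ℕ.∣_) (trans g-eq (sym (ℕ.*-identityˡ g)))
      (gcd-greatest
        (subst (d ℕ.* g ℕ.∣_) (sym (ℕ.*-assoc u d g)) (ℕ.n∣m*n u))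
        (subst (d ℕ.* g ℕ.∣_) (sym (ℕ.*-assoc v d g)) (ℕ.n∣m*n v)))))
  k′k′∣Db′b′ : k′ ℕ.* k′ ℕ.∣ (b′ ℕ.* b′) ℕ.* D
  k′k′∣Db′b′ = ℕ.*-cancelʳ-∣ (g ℕ.* g)
    (subst₂ ℕ._∣_ (ℕ.[m*n]*[o*p]≡[m*o]*[n*p] k′ g k′ g) eq kk∣Dbb)
    where
    eq : D ℕ.* (b′ ℕ.* g ℕ.* (b′ ℕ.* g)) ≡ b′ ℕ.* b′ ℕ.* D ℕ.* (g ℕ.* g)
    eq = trans (cong (D ℕ.*_) (ℕ.[m*n]*[o*p]≡[m*o]*[n*p] b′ g b′ g))
           (trans (sym (ℕ.*-assoc D (b′ ℕ.* b′) (g ℕ.* g))) (cong (ℕ._* (g ℕ.* g)) (ℕ.*-comm D (b′ ℕ.* b′))))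
  k′≡1 : k′ ≡ 1
  -- Coprimality passes to the squares one side at a time: `coprime-*` multiplies on the left only,
  -- hence the flips by symmetry.
  k′≡1 = squarefree k′ (coprime-divisor
    (coprime-* (Coprimality.sym (coprime-* (Coprimality.sym coprime) (Coprimality.sym coprime)))
               (Coprimality.sym (coprime-* (Coprimality.sym coprime) (Coprimality.sym coprime))))
    k′k′∣Db′b′)

squarefree-cancel : ∀ D k b .{{_ : NonZero k}} → Squarefree D → k * k ∣ D * (b * b) → k ∣ b
squarefree-cancel D k b squarefree kk∣Dbb = ∣ᵤ⇒∣ (squarefree-cancelℕ (∣ D ∣) (∣ k ∣) (∣ b ∣) squarefree
  (subst₂ ℕ._∣_ (ℤ.abs-* k k) (trans (ℤ.abs-* D (b * b)) (cong (∣ D ∣ ℕ.*_) (ℤ.abs-* b b))) (∣⇒∣ᵤ kk∣Dbb)))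

squarefree-1 : Squarefree (+ 1)
squarefree-1 n nn∣1 = ℕ.m*n≡1⇒m≡1 n n (ℕ.∣1⇒≡1 nn∣1)

square-cancel : ∀ k b .{{_ : NonZero k}} → k * k ∣ b * b → k ∣ b
square-cancel k b h = squarefree-cancel (+ 1) k b squarefree-1 (subst (k * k ∣_) (sym (ℤ.*-identityˡ (b * b))) h)

indivisible : ∀ {m k x} {_ : False (m ∣? k)} → m * x ≡ k → ⊥
indivisible {m} {k} {x} {m∤k} eq = toWitnessFalse m∤k (divides x (trans (sym eq) (ℤ.*-comm m x)))

parity : ∀ a → ∃[ i ] (a ≡ + 2 * i ⊎ a ≡ + 2 * i + + 1)
parity a with a %ℕ 2 | n%ℕd<d a 2 | a≡a%ℕn+[a/ℕn]*n a 2
... | 0 | _ | eq = a /ℕ 2 , inj₁ (trans eq (trans (ℤ.+-identityˡ _) (ℤ.*-comm (a /ℕ 2) (+ 2))))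
... | 1 | _ | eq = a /ℕ 2 , inj₂ (trans eq (trans (ℤ.+-comm (+ 1) (a /ℕ 2 * + 2)) (cong (_+ + 1) (ℤ.*-comm (a /ℕ 2) (+ 2)))))
... | suc (suc _) | ℕ.s≤s (ℕ.s≤s ()) | _

shift : ∀ {a b c d : ℤ} → c ≡ d → a ≡ b + (c - d) → a ≡ b
shift {b = b} {c} refl eq = trans eq (trans (cong (λ u → b + u) (ℤ.+-inverseʳ c)) (ℤ.+-identityʳ b))

-- Integrality of square roots in the fraction field

module _ (p q : ℤ) where
  open Order p q

  -- ℤ[ω] contains every square root √z lying in its field of fractions (√z = x / k).
  SquareRootsIntegral : Set
  SquareRootsIntegral = ∀ k x z .{{_ : NonZero k}} → x · x ≡ int (k * k) · z → ∃[ w ] x ≡ int k · w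

  -- x / k has integral norm n and trace τ. Taking norms gives N(x)² = k⁴ N(z), so k² divides N(x).
  -- Then Tr(x)² = Tr(x²) + 2 N(x) is divisible by k², so k divides the trace.
  norm-trace : ∀ k x z .{{_ : NonZero k}} → x · x ≡ int (k * k) · z →
    (∃[ n ] norm x ≡ k * k * n) × (∃[ τ ] + 2 * proj₁ x + proj₂ x * q ≡ k * τ)
  norm-trace k x@(a , b) z@(c , e) xx≡kkz = (n , norm≡) , τ , trans τ≡ (ℤ.*-comm τ k)
    where
    instance _ = ℤ.i*j≢0 k k
    norm-int : norm (int (k * k)) ≡ k * k * (k * k)
    norm-int = lemma (k * k) p q
      where
      lemma : ∀ m p q → m * m + m * + 0 * q - + 0 * + 0 * p ≡ m * m
      lemma = solve-∀
    norm²≡ : norm x * norm x ≡ norm z * (k * k * (k * k))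
    norm²≡ = trans (sym (norm-· x x)) (trans (cong norm xx≡kkz)
      (trans (norm-· (int (k * k)) z) (trans (cong (_* norm z) norm-int) (ℤ.*-comm _ (norm z)))))
    kk∣norm : k * k ∣ norm x
    kk∣norm = square-cancel (k * k) (norm x) (divides (norm z) norm²≡)
    n = _∣_.quotient kk∣norm
    norm≡ : norm x ≡ k * k * n
    norm≡ = trans (_∣_.equality kk∣norm) (ℤ.*-comm n (k * k))
    xx≡ : x · x ≡ (k * k * c , k * k * e)
    xx≡ = trans xx≡kkz (int-· (k * k) c e)
    trace² : ∀ a b p q → (+ 2 * a + b * q) * (+ 2 * a + b * q) ≡
      + 2 * (a * a + b * b * p) + q * (a * b + b * a + b * b * q) + + 2 * (a * a + a * b * q - b * b * p)
    trace² = solve-∀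
    collect : ∀ m c e n q → + 2 * (m * c) + q * (m * e) + + 2 * (m * n) ≡ (+ 2 * c + q * e + + 2 * n) * m
    collect = solve-∀
    k∣trace : k ∣ + 2 * a + b * q
    k∣trace = square-cancel k (+ 2 * a + b * q) (divides (+ 2 * c + q * e + + 2 * n)
      (trans (trace² a b p q) (trans
        (cong₂ _+_ (cong₂ (λ u v → + 2 * u + q * v) (cong proj₁ xx≡) (cong proj₂ xx≡)) (cong (+ 2 *_) norm≡))
        (collect (k * k) c e n q))))
    τ = _∣_.quotient k∣trace
    τ≡ = _∣_.equality k∣trace

-- Both sides are Tr(x)² - 4 N(x) for x = a + b ω, computed from the coordinates and from the trace
-- and norm of x / k.
discriminant : ∀ a b p q k n τ →
  a * a + a * b * q - b * b * p ≡ k * k * n → + 2 * a + b * q ≡ k * τ →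
  (q * q + + 4 * p) * (b * b) ≡ (τ * τ - + 4 * n) * (k * k)
discriminant a b p q k n τ norm≡ trace≡ =
  trans (disc a b p q) (trans (cong₂ (λ u v → u * u - + 4 * v) trace≡ norm≡) (collect k τ n))
  where
  disc : ∀ a b p q → (q * q + + 4 * p) * (b * b) ≡
    (+ 2 * a + b * q) * (+ 2 * a + b * q) - + 4 * (a * a + a * b * q - b * b * p)
  disc = solve-∀
  collect : ∀ k τ n → k * τ * (k * τ) - + 4 * (k * k * n) ≡ (τ * τ - + 4 * n) * (k * k)
  collect = solve-∀

cancel-squares : ∀ D k β m .{{_ : NonZero k}} → D * (β * k * (β * k)) ≡ m * (k * k) → D * (β * β) ≡ m
cancel-squares D k β m eq = ℤ.*-cancelʳ-≡ (D * (β * β)) m (k * k) (trans (square k β D) eq)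
  where
  instance _ = ℤ.i*j≢0 k k
  square : ∀ k β D → D * (β * β) * (k * k) ≡ D * (β * k * (β * k))
  square = solve-∀

halve : ∀ k a i τ → + 2 * a ≡ k * τ → τ ≡ + 2 * i → a ≡ k * i
halve k a i τ 2a≡kτ refl = ℤ.*-cancelˡ-≡ (+ 2) a (k * i) (trans 2a≡kτ (swap k i))
  where
  swap : ∀ k i → k * (+ 2 * i) ≡ + 2 * (k * i)
  swap = solve-∀

-- Modulo 2 the hypothesis reads β² ≡ τ². If τ - β were odd, the same equation would make 1 even.
same-parity : ∀ τ β n p → (+ 1 + + 4 * p) * (β * β) ≡ τ * τ - + 4 * n → ∃[ i ] τ - β ≡ + 2 * i
same-parity τ β n p disc with parity (τ - β)
... | i , inj₁ eq = i , eq
... | i , inj₂ eq = ⊥-elim (indivisible {+ 2} {+ 1} (shift disc′ (residue i β n p)))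
  where
  disc′ : (+ 1 + + 4 * p) * (β * β) ≡ (+ 2 * i + + 1 + β) * (+ 2 * i + + 1 + β) - + 4 * n
  disc′ = trans disc (cong (λ u → u * u - + 4 * n) (trans (split τ β) (cong (_+ β) eq)))
    where
    split : ∀ τ β → τ ≡ τ - β + β
    split = solve-∀
  residue : ∀ i β n p → + 2 * (+ 2 * p * (β * β) + + 2 * n - + 2 * (i * i) - + 2 * i - (+ 2 * i + + 1) * β) ≡
    + 1 + ((+ 1 + + 4 * p) * (β * β) - ((+ 2 * i + + 1 + β) * (+ 2 * i + + 1 + β) - + 4 * n))
  residue = solve-∀

-- Comparing discriminants gives D b² = (τ² - 4 n) k², hence b = β k. The trace then reads 2 a = k
-- (τ - β), and τ - β is even.
integral-one : ∀ D p → Squarefree D → D ≡ + 1 + + 4 * p → SquareRootsIntegral p (+ 1)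
integral-one D p squarefree D≡ k x@(a , b) z xx≡kkz = from-norm-trace (norm-trace p (+ 1) k x z xx≡kkz)
  where
  open Order p (+ 1)
  double : ∀ a b → + 2 * a ≡ + 2 * a + b * + 1 - b
  double = solve-∀
  factor : ∀ k τ β → k * τ - β * k ≡ k * (τ - β)
  factor = solve-∀
  from-norm-trace : (∃[ n ] norm x ≡ k * k * n) × (∃[ τ ] + 2 * a + b * + 1 ≡ k * τ) → ∃[ w ] x ≡ int k · w
  from-norm-trace ((n , norm≡) , τ , trace≡) =
    from-divisor (squarefree-cancel D k b squarefree (divides (τ * τ - + 4 * n) Dbb≡))
    where
    Dbb≡ : D * (b * b) ≡ (τ * τ - + 4 * n) * (k * k)
    Dbb≡ = trans (cong (_* (b * b)) D≡) (discriminant a b p (+ 1) k n τ norm≡ trace≡)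
    from-divisor : k ∣ b → ∃[ w ] x ≡ int k · w
    from-divisor (divides β b≡βk) = from-parity (same-parity τ β n p
        (cancel-squares (+ 1 + + 4 * p) k β (τ * τ - + 4 * n)
          (trans (cong₂ (λ u v → u * (v * v)) (sym D≡) (sym b≡βk)) Dbb≡)))
      where
      2a≡ : + 2 * a ≡ k * (τ - β)
      2a≡ = trans (double a b) (trans (cong₂ _-_ trace≡ b≡βk) (factor k τ β))
      from-parity : ∃[ i ] τ - β ≡ + 2 * i → ∃[ w ] x ≡ int k · w
      from-parity (i , σ≡2i) =
        (i , β) , trans (cong₂ _,_ (halve k a i (τ - β) 2a≡ σ≡2i) (trans b≡βk (ℤ.*-comm β k))) (sym (int-· k i β))

data Residue (D : ℤ) : Set where
  two   : ∀ m → D ≡ + 2 + + 4 * m → Residue D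
  three : ∀ m → D ≡ + 3 + + 4 * m → Residue D

-- Squares are 0 or 1 modulo 4, so for D ≡ 2 or 3 an odd τ or β leaves a nonzero residue of τ² - D
-- β² modulo 4. Each `residue` below exhibits it.
halves-even : ∀ {D τ β n} → Residue D → τ * τ - D * (β * β) ≡ + 4 * n →
  ∃[ i ] ∃[ j ] (τ ≡ + 2 * i × β ≡ + 2 * j)
halves-even {D} {τ} {β} {n} res eq with parity τ | parity β | res
... | i , inj₁ τ≡ | j , inj₁ β≡ | _ = i , j , τ≡ , β≡
... | i , inj₂ refl | j , inj₁ refl | _ =
  ⊥-elim (indivisible {+ 4} {+ 1} (shift (sym eq) (residue i j n D)))
  where
  residue : ∀ i j n D → + 4 * (n - i * i - i + D * j * j) ≡
    + 1 + (+ 4 * n - ((+ 2 * i + + 1) * (+ 2 * i + + 1) - D * (+ 2 * j * (+ 2 * j))))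
  residue = solve-∀
... | i , inj₁ refl | j , inj₂ refl | two m refl =
  ⊥-elim (indivisible {+ 4} {+ 2} (shift eq (residue i j n m)))
  where
  residue : ∀ i j n m → + 4 * (i * i - + 2 * (j * j + j) - m * (+ 2 * j + + 1) * (+ 2 * j + + 1) - n) ≡
    + 2 + (+ 2 * i * (+ 2 * i) - (+ 2 + + 4 * m) * ((+ 2 * j + + 1) * (+ 2 * j + + 1)) - + 4 * n)
  residue = solve-∀
... | i , inj₁ refl | j , inj₂ refl | three m refl =
  ⊥-elim (indivisible {+ 4} {+ 3} (shift eq (residue i j n m)))
  where
  residue : ∀ i j n m → + 4 * (i * i - + 3 * (j * j + j) - m * (+ 2 * j + + 1) * (+ 2 * j + + 1) - n) ≡
    + 3 + (+ 2 * i * (+ 2 * i) - (+ 3 + + 4 * m) * ((+ 2 * j + + 1) * (+ 2 * j + + 1)) - + 4 * n)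
  residue = solve-∀
... | i , inj₂ refl | j , inj₂ refl | two m refl =
  ⊥-elim (indivisible {+ 4} {+ 1} (shift eq (residue i j n m)))
  where
  residue : ∀ i j n m → + 4 * (i * i + i - + 2 * (j * j + j) - m * (+ 2 * j + + 1) * (+ 2 * j + + 1) - n) ≡
    + 1 + ((+ 2 * i + + 1) * (+ 2 * i + + 1) - (+ 2 + + 4 * m) * ((+ 2 * j + + 1) * (+ 2 * j + + 1)) - + 4 * n)
  residue = solve-∀
... | i , inj₂ refl | j , inj₂ refl | three m refl =
  ⊥-elim (indivisible {+ 4} {+ 2} (shift eq (residue i j n m)))
  where
  residue : ∀ i j n m → + 4 * (i * i + i - + 3 * (j * j + j) - m * (+ 2 * j + + 1) * (+ 2 * j + + 1) - n) ≡
    + 2 + ((+ 2 * i + + 1) * (+ 2 * i + + 1) - (+ 3 + + 4 * m) * ((+ 2 * j + + 1) * (+ 2 * j + + 1)) - + 4 * n)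
  residue = solve-∀

-- Here the trace is 2 a and the discriminant is 4 D, so the argument first yields only the
-- half-integral coordinates τ / 2 and β / 2 of x / k. Integrality of the norm then makes τ and β
-- even.
integral-two-three : ∀ D → Squarefree D → Residue D → SquareRootsIntegral D (+ 0)
integral-two-three D squarefree residue k x@(a , b) z xx≡kkz = from-norm-trace (norm-trace D (+ 0) k x z xx≡kkz)
  where
  open Order D (+ 0)
  trace : ∀ a b → + 2 * a ≡ + 2 * a + b * + 0
  trace = solve-∀
  quadruple : ∀ D b → D * (+ 2 * b * (+ 2 * b)) ≡ (+ 0 * + 0 + + 4 * D) * (b * b)
  quadruple = solve-∀
  cancel : ∀ t n → t - (t - + 4 * n) ≡ + 4 * n
  cancel = solve-∀
  from-norm-trace : (∃[ n ] norm x ≡ k * k * n) × (∃[ τ ] + 2 * a + b * + 0 ≡ k * τ) → ∃[ w ] x ≡ int k · w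
  from-norm-trace ((n , norm≡) , τ , trace≡) =
    from-divisor (squarefree-cancel D k (+ 2 * b) squarefree (divides (τ * τ - + 4 * n) D2b2b≡))
    where
    D2b2b≡ : D * (+ 2 * b * (+ 2 * b)) ≡ (τ * τ - + 4 * n) * (k * k)
    D2b2b≡ = trans (quadruple D b) (discriminant a b D (+ 0) k n τ norm≡ trace≡)
    from-divisor : k ∣ + 2 * b → ∃[ w ] x ≡ int k · w
    from-divisor (divides β 2b≡βk) = from-halves (halves-even residue disc)
      where
      disc : τ * τ - D * (β * β) ≡ + 4 * n
      disc = trans (cong (λ u → τ * τ - u) (cancel-squares D k β (τ * τ - + 4 * n)
          (trans (cong (λ v → D * (v * v)) (sym 2b≡βk)) D2b2b≡)))
        (cancel (τ * τ) n)
      from-halves : ∃[ i ] ∃[ j ] (τ ≡ + 2 * i × β ≡ + 2 * j) → ∃[ w ] x ≡ int k · w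
      from-halves (i , j , τ≡2i , β≡2j) =
        (i , j) , trans (cong₂ _,_ (halve k a i τ (trans (trace a b) trace≡) τ≡2i)
                                  (halve k b j β (trans 2b≡βk (ℤ.*-comm β k)) β≡2j))
                       (sym (int-· k i j))

-- Residue classes of D modulo 4

-- Maximal D p q: the maximal order of ℚ(√D) is ℤ[ω] with ω² = p + q ω.
data Maximal : ℤ → ℤ → ℤ → Set where
  one       : ∀ m → Maximal (+ 1 + + 4 * -[1+ m ]) -[1+ m ] (+ 1)
  two-three : ∀ m → Residue -[1+ m ] → Maximal -[1+ m ] -[1+ m ] (+ 0)

negative : ∀ {D} → D < + 0 → ∃[ m ] D ≡ -[1+ m ]
negative { -[1+ m ]} _ = m , refl
negative {+ _} (_<_.+<+ ())

[D-1]/4 : ∀ D k → D ≡ + 1 + k * + 4 → (D - + 1) /ℕ 4 ≡ k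
[D-1]/4 D k D≡ = lemma (D - + 1) k (trans (cong (_- + 1) D≡) (cancel k))
  where
  cancel : ∀ k → + 1 + k * + 4 - + 1 ≡ + 4 * k
  cancel = solve-∀
  difference : ∀ r c k → r + c * + 4 - + 4 * k ≡ r - + 4 * (k - c)
  difference = solve-∀
  remainder : ∀ r c k → r + c * + 4 ≡ + 4 * k → + 4 * (k - c) ≡ r
  remainder r c k eq = shift (sym eq) (lemma′ r c k)
    where
    lemma′ : ∀ r c k → + 4 * (k - c) ≡ r + (+ 4 * k - (r + c * + 4))
    lemma′ = solve-∀
  lemma : ∀ e k → e ≡ + 4 * k → e /ℕ 4 ≡ k
  lemma e k e≡ with e %ℕ 4 | e /ℕ 4 | n%ℕd<d e 4 | a≡a%ℕn+[a/ℕn]*n e 4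
  ... | 0 | c | _ | eq = sym (ℤ.*-cancelˡ-≡ (+ 4) k c
    (trans (sym e≡) (trans eq (trans (ℤ.+-identityˡ (c * + 4)) (ℤ.*-comm c (+ 4))))))
  ... | 1 | c | _ | eq = ⊥-elim (indivisible {+ 4} {+ 1} (remainder (+ 1) c k (trans (sym eq) e≡)))
  ... | 2 | c | _ | eq = ⊥-elim (indivisible {+ 4} {+ 2} (remainder (+ 2) c k (trans (sym eq) e≡)))
  ... | 3 | c | _ | eq = ⊥-elim (indivisible {+ 4} {+ 3} (remainder (+ 3) c k (trans (sym eq) e≡)))
  ... | suc (suc (suc (suc _))) | _ | ℕ.s≤s (ℕ.s≤s (ℕ.s≤s (ℕ.s≤s ()))) | _

maximal-two-three : ∀ {D} → ∃[ m ] D ≡ -[1+ m ] → Residue D → Maximal D D (+ 0)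
maximal-two-three (m , refl) = two-three m

maximal : ∀ D → Squarefree D → D < + 0 → Maximal D (proj₁ (ωSq D)) (proj₂ (ωSq D))
maximal D squarefree D<0 with D %ℕ 4 | n%ℕd<d D 4 | a≡a%ℕn+[a/ℕn]*n D 4
-- Here 4 divides `D`, against squarefreeness.
... | 0 | _ | D≡ = contradiction (squarefree 2 (ℕ.divides ∣ D /ℕ 4 ∣
  (trans (cong ∣_∣ (trans D≡ (ℤ.+-identityˡ (D /ℕ 4 * + 4)))) (ℤ.abs-* (D /ℕ 4) (+ 4))))) λ ()
... | 1 | _ | D≡ = lemma (D /ℕ 4) ((D - + 1) /ℕ 4) D≡ ([D-1]/4 D (D /ℕ 4) D≡) D<0
  where
  lemma : ∀ {D} k c → D ≡ + 1 + k * + 4 → c ≡ k → D < + 0 → Maximal D c (+ 1)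
  lemma -[1+ m ] c D≡ refl _ =
    subst (λ D → Maximal D -[1+ m ] (+ 1)) (sym (trans D≡ (cong (λ u → + 1 + u) (ℤ.*-comm -[1+ m ] (+ 4))))) (one m)
  lemma (+ k) c refl refl D<0 with subst (_< + 0) (cong (λ u → + 1 + u) (sym (ℤ.pos-* k 4))) D<0
  ... | _<_.+<+ ()
... | 2 | _ | D≡ = maximal-two-three (negative D<0)
  (two (D /ℕ 4) (trans D≡ (cong (λ u → + 2 + u) (ℤ.*-comm (D /ℕ 4) (+ 4)))))
... | 3 | _ | D≡ = maximal-two-three (negative D<0)
  (three (D /ℕ 4) (trans D≡ (cong (λ u → + 3 + u) (ℤ.*-comm (D /ℕ 4) (+ 4)))))
... | suc (suc (suc (suc _))) | ℕ.s≤s (ℕ.s≤s (ℕ.s≤s (ℕ.s≤s ()))) | _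

-- Definiteness of the norm

square-abs : ∀ a → a * a ≡ + (∣ a ∣ ℕ.* ∣ a ∣)
square-abs (+ n) = sym (ℤ.pos-* n n)
square-abs -[1+ n ] = refl

∣disc∣ : ∀ {D p q} → Maximal D p q → ℕ
∣disc∣ (one m) = 3 ℕ.+ 4 ℕ.* m
∣disc∣ (two-three m _) = 4 ℕ.+ 4 ℕ.* m

∣disc∣-correct : ∀ {D p q} (M : Maximal D p q) → + ∣disc∣ M ≡ - (q * q + + 4 * p)
∣disc∣-correct (one m) = trans (cong (λ u → + 3 + u) (ℤ.pos-* 4 m)) (lemma (+ m))
  where
  lemma : ∀ m → + 3 + + 4 * m ≡ - (+ 1 + + 4 * (- (+ 1 + m)))
  lemma = solve-∀
∣disc∣-correct (two-three m _) = trans (cong (λ u → + 4 + u) (ℤ.pos-* 4 m)) (lemma (+ m))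
  where
  lemma : ∀ m → + 4 + + 4 * m ≡ - (+ 0 + + 4 * (- (+ 1 + m)))
  lemma = solve-∀

sum-of-squares : ∀ {D p q} (M : Maximal D p q) a b →
  a * a + - (q * q + + 4 * p) * (b * b) ≡ + (∣ a ∣ ℕ.* ∣ a ∣ ℕ.+ ∣disc∣ M ℕ.* (∣ b ∣ ℕ.* ∣ b ∣))
sum-of-squares M a b = cong₂ _+_ (square-abs a)
  (trans (cong₂ _*_ (sym (∣disc∣-correct M)) (square-abs b)) (sym (ℤ.pos-* (∣disc∣ M) (∣ b ∣ ℕ.* ∣ b ∣))))

square≡0 : ∀ a → ∣ a ∣ ℕ.* ∣ a ∣ ≡ 0 → a ≡ + 0
square≡0 a eq with ℕ.m*n≡0⇒m≡0∨n≡0 (∣ a ∣) eq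
... | inj₁ h = ℤ.∣i∣≡0⇒i≡0 h
... | inj₂ h = ℤ.∣i∣≡0⇒i≡0 h

-- Four times the norm is (2 a + b q)² + |disc| b², a sum of nonnegative terms because `D` is
-- negative.
norm≡0 : ∀ {D p q} → Maximal D p q → ∀ x → Order.norm p q x ≡ + 0 → x ≡ (+ 0 , + 0)
norm≡0 {D} {p} {q} M (a , b) eq = cong₂ _,_ a≡0 b≡0
  where
  complete : ∀ a b p q → (+ 2 * a + b * q) * (+ 2 * a + b * q) + - (q * q + + 4 * p) * (b * b)
    ≡ + 4 * (a * a + a * b * q - b * b * p)
  complete = solve-∀
  t = + 2 * a + b * q
  sum≡0 : ∣ t ∣ ℕ.* ∣ t ∣ ℕ.+ ∣disc∣ M ℕ.* (∣ b ∣ ℕ.* ∣ b ∣) ≡ 0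
  sum≡0 = ℤ.+-injective (trans (sym (sum-of-squares M t b)) (trans (complete a b p q) (cong (+ 4 *_) eq)))
  disc≢0 : ∀ {D p q} (M : Maximal D p q) → ℕ.NonZero (∣disc∣ M)
  disc≢0 (one _) = _
  disc≢0 (two-three _ _) = _
  b≡0 : b ≡ + 0
  b≡0 with ℕ.m*n≡0⇒m≡0∨n≡0 (∣disc∣ M) (ℕ.m+n≡0⇒n≡0 (∣ t ∣ ℕ.* ∣ t ∣) sum≡0)
  ... | inj₁ h = ⊥-elim (ℕ.≢-nonZero⁻¹ (∣disc∣ M) {{disc≢0 M}} h)
  ... | inj₂ h = square≡0 b h
  2a≡0 : + 2 * a ≡ + 0
  2a≡0 = trans (sym (trans (cong (λ u → + 2 * a + u * q) b≡0) (ℤ.+-identityʳ (+ 2 * a))))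
               (square≡0 t (ℕ.m+n≡0⇒m≡0 (∣ t ∣ ℕ.* ∣ t ∣) sum≡0))
  a≡0 : a ≡ + 0
  a≡0 = ℤ.*-cancelˡ-≡ (+ 2) a (+ 0) 2a≡0

-- Enumeration of small norms

small-square : ∀ a → a ℕ.* a ℕ.≤ 25 → a ℕ.< 6
small-square a aa≤25 = ℕ.≰⇒> λ 6≤a →
  ℕ.<⇒≱ (ℕ.≤-<-trans aa≤25 (ℕ.m<n+m 25 {11} ℕ.z<s)) (ℕ.*-mono-≤ 6≤a 6≤a)

-- The second coordinate is `suc b`. Both b ≥ 2 and m ≥ 6 push the second summand to at least 27 =
-- 25 + 2: as 3 · 3² in one case, as 3 + 4 · 6 in the other.
small-form : ∀ c a b m → 3 ℕ.≤ c → a ℕ.* a ℕ.+ (c ℕ.+ 4 ℕ.* m) ℕ.* (suc b ℕ.* suc b) ℕ.≤ 25 →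
  a ℕ.< 6 × b ℕ.< 2 × m ℕ.< 6
small-form c a b m 3≤c le =
    small-square a (ℕ.≤-trans (ℕ.m≤m+n _ _) le)
  , ℕ.≰⇒> (λ 2≤b → ℕ.<⇒≱ (ℕ.≤-<-trans Δbb≤25 (ℕ.m<n+m 25 {2} ℕ.z<s))
      (ℕ.*-mono-≤ (ℕ.≤-trans 3≤c (ℕ.m≤m+n c (4 ℕ.* m))) (ℕ.*-mono-≤ (ℕ.s≤s 2≤b) (ℕ.s≤s 2≤b))))
  , ℕ.≰⇒> (λ 6≤m → ℕ.<⇒≱ (ℕ.≤-<-trans Δbb≤25 (ℕ.m<n+m 25 {2} ℕ.z<s))
      (ℕ.*-mono-≤ {x = 27} (ℕ.+-mono-≤ 3≤c (ℕ.*-monoʳ-≤ 4 6≤m)) (ℕ.s≤s (ℕ.z≤n {b ℕ.+ b ℕ.* suc b}))))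
  where
  Δbb≤25 = ℕ.≤-trans (ℕ.m≤n+m _ (a ℕ.* a)) le

below : ∀ {P : ℕ → Set} n → (∀ (i : Fin n) → P (toℕ i)) → ∀ {a} → a ℕ.< n → P a
below {P} n f a<n = subst P (Fin.toℕ-fromℕ< a<n) (f (fromℕ< a<n))

-- With c + 4 m the absolute value of the discriminant, the norm of 2 u − 1 has this shape.
form : ℕ → ℕ → ℕ → ℕ → ℕ
form c a b m = a ℕ.* a ℕ.+ (c ℕ.+ 4 ℕ.* m) ℕ.* (b ℕ.* b)

-- The two norms multiply to 625, so the smaller one is also a divisor of 625: only 1, 5 and 25
-- remain.
Small : ℕ → Set
Small n = n ℕ.≤ 25 × n ℕ.∣ 625

small? : ∀ n → Dec (Small n)
small? n = n ℕ.≤? 25 ×-dec n ℕ.∣? 625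

flat-values : List ℕ
flat-values = 1 ∷ 5 ∷ []

-- With second coordinate 0 the discriminant drops out, so a single search serves all fields at
-- once.
flat-forms : ∀ c a m → Small (form c a 0 m) → a ∈ flat-values
flat-forms c a m small = below {λ a → Small (a ℕ.* a) → a ∈ flat-values} 6
  (from-yes (Fin.all? λ (i : Fin 6) → small? (toℕ i ℕ.* toℕ i) →-dec (toℕ i ∈?ℕ flat-values)))
  (small-square a (proj₁ small′)) small′
  where
  open DecMembership ℕ._≟_ using () renaming (_∈?_ to _∈?ℕ_)
  small′ : Small (a ℕ.* a)
  small′ = subst Small (trans (cong (a ℕ.* a ℕ.+_) (ℕ.*-zeroʳ (c ℕ.+ 4 ℕ.* m))) (ℕ.+-identityʳ (a ℕ.* a))) small

-- Representations of 1, 5 or 25 with nonzero second coordinate. For `c = 3` there are none: these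
-- values are 1 modulo 4, so coordinate 1 would leave a square that is 2 modulo 4, and coordinate 2
-- would leave 25 - 12 = 13. For `c = 4` the last component m stands for D = -(m + 1), so the
-- entries belong to D = -1, -6, -4 and -1.
forms : ℕ → List (ℕ × ℕ × ℕ)
forms 3 = []
forms _ = (1 , 1 , 0) ∷ (1 , 1 , 5) ∷ (3 , 1 , 3) ∷ (3 , 2 , 0) ∷ []

SteepForm : ℕ → ℕ → ℕ → ℕ → Set
SteepForm c a b m = Small (form c a (suc b) m) → (a , suc b , m) ∈ forms c

steepForm? : ∀ c a b m → Dec (SteepForm c a b m)
steepForm? c a b m = small? (form c a (suc b) m) →-dec ((a , suc b , m) ∈? forms c)
  where
  open DecMembership (≡-dec ℕ._≟_ (≡-dec ℕ._≟_ ℕ._≟_)) using (_∈?_)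

steep-forms : ∀ c → 3 ℕ.≤ c →
  (∀ (i : Fin 6) (j : Fin 2) (k : Fin 6) → SteepForm c (toℕ i) (toℕ j) (toℕ k)) →
  ∀ a b m → SteepForm c a b m
steep-forms c 3≤c f a b m small =
  below {λ a → SteepForm c a b m} 6 (λ i →
    below {λ b → SteepForm c (toℕ i) b m} 2 (λ j →
      below {λ m → SteepForm c (toℕ i) (toℕ j) m} 6 (f i j) m<6) b<2) a<6 small
  where
  bounds = small-form c a b m 3≤c (proj₁ small)
  a<6 = proj₁ bounds
  b<2 = proj₁ (proj₂ bounds)
  m<6 = proj₂ (proj₂ bounds)

steep-forms-3 : ∀ a b m → SteepForm 3 a b m
steep-forms-3 = steep-forms 3 ℕ.≤-refl
  (from-yes (Fin.all? λ (i : Fin 6) → Fin.all? λ (j : Fin 2) → Fin.all? λ (k : Fin 6) →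
    steepForm? 3 (toℕ i) (toℕ j) (toℕ k)))

steep-forms-4 : ∀ a b m → SteepForm 4 a b m
steep-forms-4 = steep-forms 4 (ℕ.m≤m+n 3 1)
  (from-yes (Fin.all? λ (i : Fin 6) → Fin.all? λ (j : Fin 2) → Fin.all? λ (k : Fin 6) →
    steepForm? 4 (toℕ i) (toℕ j) (toℕ k)))

-- From a factor of small norm to the pair (t , w)

Pair : Set
Pair = ℤ × ℤ

odd : Pair → Pair
odd (a , b) = + 2 * a + - + 1 , + 2 * b

abs-cases : ∀ a {n} → ∣ a ∣ ≡ n → a ≡ + n ⊎ a ≡ - + n
abs-cases (+ n) refl = inj₁ refl
abs-cases -[1+ n ] refl = inj₂ refl

cancel-double : ∀ n a b {k} .{{_ : NonZero n}} → n * (+ 2 * a) ≡ k → n * (+ 2 * b) ≡ k → a ≡ b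
cancel-double n a b p q = ℤ.*-cancelˡ-≡ (+ 2) a b (ℤ.*-cancelˡ-≡ n (+ 2 * a) (+ 2 * b) (trans p (sym q)))

odd-injective : ∀ a b {c} → + 2 * a + - + 1 ≡ c → + 2 * b + - + 1 ≡ c → a ≡ b
odd-injective a b p q = ℤ.*-cancelˡ-≡ (+ 2) a b (shift (trans p (sym q)) (lemma a b))
  where
  lemma : ∀ a b → + 2 * a ≡ + 2 * b + ((+ 2 * a + - + 1) - (+ 2 * b + - + 1))
  lemma = solve-∀

cancel-odd : ∀ n a b {k} .{{_ : NonZero n}} →
  n * (+ 2 * a + - + 1) ≡ k → n * (+ 2 * b + - + 1) ≡ k → a ≡ b
cancel-odd n a b p q =
  odd-injective a b (ℤ.*-cancelˡ-≡ n (+ 2 * a + - + 1) (+ 2 * b + - + 1) (trans p (sym q))) refl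

half-sum : ∀ {t w u v} T W → t - w ≡ u → t + w ≡ v → + 2 * T ≡ u + v → + 2 * W ≡ v - u → t ≡ T × w ≡ W
half-sum {t} {w} T W refl refl 2T≡ 2W≡ =
    ℤ.*-cancelˡ-≡ (+ 2) t T (trans (sum t w) (sym 2T≡))
  , ℤ.*-cancelˡ-≡ (+ 2) w W (trans (difference t w) (sym 2W≡))
  where
  sum : ∀ t w → + 2 * t ≡ t - w + (t + w)
  sum = solve-∀
  difference : ∀ t w → + 2 * w ≡ t + w - (t - w)
  difference = solve-∀

-- The pairs (t , w) with w² = (t − 3)(t + 2); the sign of w is fixed by N(2 (t − w) − 1) ≤ 25.
rational-roots gaussian-roots ℚ√-6-roots : List (Pair × Pair)
rational-roots =
    ((+ 7 , + 0) , (+ 6 , + 0))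
  ∷ ((- + 6 , + 0) , (- + 6 , + 0))
  ∷ ((+ 3 , + 0) , (+ 0 , + 0))
  ∷ ((- + 2 , + 0) , (+ 0 , + 0))
  ∷ []
gaussian-roots =
    ((+ 2 , - + 2) , (+ 1 , - + 3))
  ∷ ((+ 2 , + 2) , (+ 1 , + 3))
  ∷ ((- + 1 , - + 2) , (- + 1 , - + 3))
  ∷ ((- + 1 , + 2) , (- + 1 , + 3))
  ∷ ((+ 2 , + 0) , (+ 0 , - + 2))
  ∷ ((+ 2 , + 0) , (+ 0 , + 2))
  ∷ ((- + 1 , + 0) , (+ 0 , - + 2))
  ∷ ((- + 1 , + 0) , (+ 0 , + 2))
  ∷ []
ℚ√-6-roots =
    ((+ 1 , + 0) , (+ 0 , - + 1))
  ∷ ((+ 1 , + 0) , (+ 0 , + 1))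
  ∷ ((+ 0 , + 0) , (+ 0 , - + 1))
  ∷ ((+ 0 , + 0) , (+ 0 , + 1))
  ∷ []

data Root : (D : ℤ) → ℤ → ℤ → Pair → Pair → Set where
  rational : ∀ {D p q t w} → (t , w) ∈ rational-roots → Root D p q t w
  gaussian : ∀ {t w} → (t , w) ∈ gaussian-roots → Root (- + 1) (- + 1) (+ 0) t w
  ℚ√-6     : ∀ {t w} → (t , w) ∈ ℚ√-6-roots → Root (- + 6) (- + 6) (+ 0) t w

module _ {D p q : ℤ} (M : Maximal D p q) where
  open Order p q

  size : Pair → ℕ
  size (a , b) = form-of M (∣ + 2 * a + - + 1 + b * q ∣) (∣ b ∣)
    where
    form-of : ∀ {D p q} → Maximal D p q → ℕ → ℕ → ℕ
    form-of M a b = a ℕ.* a ℕ.+ ∣disc∣ M ℕ.* (b ℕ.* b)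

  -- The ω-coordinate of 2 u - 1 is even, so the square can be completed without denominators and b²
  -- keeps the full |disc| as coefficient.
  norm-odd : ∀ u → norm (odd u) ≡ + size u
  norm-odd (a , b) = trans (complete a b p q) (sum-of-squares M (+ 2 * a + - + 1 + b * q) b)
    where
    complete : ∀ a b p q →
      (+ 2 * a + - + 1) * (+ 2 * a + - + 1) + (+ 2 * a + - + 1) * (+ 2 * b) * q - + 2 * b * (+ 2 * b) * p
      ≡ (+ 2 * a + - + 1 + b * q) * (+ 2 * a + - + 1 + b * q) + - (q * q + + 4 * p) * (b * b)
    complete = solve-∀

  module _ {t w : Pair} (factors : odd (t ⊖ w) · odd (t ⊕ w) ≡ int (+ 25)) where

    -- Multiply the factorisation of 25 by the conjugate of the first factor.
    cofactor : ∀ {u} → t ⊖ w ≡ u → int (norm (odd u)) · odd (t ⊕ w) ≡ int (+ 25) · conj (odd u)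
    cofactor {u} refl = begin
      int (norm α) · β   ≡⟨ cong (_· β) (sym (·-conj α)) ⟩
      α · conj α · β     ≡⟨ cong (_· β) (*-comm α (conj α)) ⟩
      conj α · α · β     ≡⟨ *-assoc (conj α) α β ⟩
      conj α · (α · β)   ≡⟨ cong (conj α ·_) factors ⟩
      conj α · int (+ 25) ≡⟨ *-comm (conj α) (int (+ 25)) ⟩
      int (+ 25) · conj α ∎
      where
      open ≡-Reasoning
      α = odd u
      β = odd (t ⊕ w)

    -- Here v is the value forced on t + w, and T and W are the half sum and half difference. On
    -- numerals the last three hypotheses hold by computation, so each use supplies `refl`.
    recover : ∀ u v T W .{{_ : NonZero (norm (odd u))}} → t ⊖ w ≡ u →
      (norm (odd u) * proj₁ (odd v) , norm (odd u) * proj₂ (odd v)) ≡ int (+ 25) · conj (odd u) →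
      (+ 2 * proj₁ T , + 2 * proj₂ T) ≡ u ⊕ v → (+ 2 * proj₁ W , + 2 * proj₂ W) ≡ v ⊖ u →
      (t , w) ≡ (T , W)
    recover u v T W t⊖w≡u v≡ 2T≡ 2W≡ = cong₂ _,_ (cong₂ _,_ (proj₁ h₁) (proj₁ h₂)) (cong₂ _,_ (proj₂ h₁) (proj₂ h₂))
      where
      n = norm (odd u)
      β = odd (t ⊕ w)
      cofactor≡ : (n * proj₁ β , n * proj₂ β) ≡ int (+ 25) · conj (odd u)
      cofactor≡ = trans (sym (int-· n (proj₁ β) (proj₂ β))) (cofactor t⊖w≡u)
      h₁ = half-sum (proj₁ T) (proj₁ W) (cong proj₁ t⊖w≡u)
        (cancel-odd n (proj₁ (t ⊕ w)) (proj₁ v) (cong proj₁ cofactor≡) (cong proj₁ v≡)) (cong proj₁ 2T≡) (cong proj₁ 2W≡)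
      h₂ = half-sum (proj₂ T) (proj₂ W) (cong proj₂ t⊖w≡u)
        (cancel-double n (proj₂ (t ⊕ w)) (proj₂ v) (cong proj₂ cofactor≡) (cong proj₂ v≡)) (cong proj₂ 2T≡) (cong proj₂ 2W≡)

+-cancel-0 : ∀ {a b} → a + + 0 ≡ b → a ≡ b
+-cancel-0 {a} eq = trans (sym (ℤ.+-identityʳ a)) eq

flat-root : ∀ {D p q} (M : Maximal D p q) {t w} → let open Order p q in
  odd (t ⊖ w) · odd (t ⊕ w) ≡ int (+ 25) → ∀ {a A} → t ⊖ w ≡ (a , + 0) →
  + 2 * a + - + 1 + + 0 ≡ + A ⊎ + 2 * a + - + 1 + + 0 ≡ - + A → A ∈ flat-values → Root D p q t w
flat-root M factors {a} u≡ (inj₁ a≡) (here refl) =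
  rational (subst (_∈ rational-roots) (sym (recover M factors (+ 1 , + 0) (+ 13 , + 0) (+ 7 , + 0) (+ 6 , + 0)
    (trans u≡ (cong (_, + 0) (odd-injective a (+ 1) (+-cancel-0 a≡) refl))) refl refl refl)) (here refl))
flat-root M factors {a} u≡ (inj₂ a≡) (here refl) =
  rational (subst (_∈ rational-roots) (sym (recover M factors (+ 0 , + 0) (- + 12 , + 0) (- + 6 , + 0) (- + 6 , + 0)
    (trans u≡ (cong (_, + 0) (odd-injective a (+ 0) (+-cancel-0 a≡) refl))) refl refl refl)) (there (here refl)))
flat-root M factors {a} u≡ (inj₁ a≡) (there (here refl)) =
  rational (subst (_∈ rational-roots) (sym (recover M factors (+ 3 , + 0) (+ 3 , + 0) (+ 3 , + 0) (+ 0 , + 0)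
    (trans u≡ (cong (_, + 0) (odd-injective a (+ 3) (+-cancel-0 a≡) refl))) refl refl refl)) (there (there (here refl))))
flat-root M factors {a} u≡ (inj₂ a≡) (there (here refl)) =
  rational (subst (_∈ rational-roots) (sym (recover M factors (- + 2 , + 0) (- + 2 , + 0) (- + 2 , + 0) (+ 0 , + 0)
    (trans u≡ (cong (_, + 0) (odd-injective a (- + 2) (+-cancel-0 a≡) refl))) refl refl refl)) (there (there (there (here refl)))))

steep-root : ∀ {m} → Residue -[1+ m ] → ∀ {t w} → let open Order -[1+ m ] (+ 0) in
  odd (t ⊖ w) · odd (t ⊕ w) ≡ int (+ 25) → ∀ {a b A B} → t ⊖ w ≡ (a , b) →
  + 2 * a + - + 1 + + 0 ≡ + A ⊎ + 2 * a + - + 1 + + 0 ≡ - + A → b ≡ + B ⊎ b ≡ - + B →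
  (A , B , m) ∈ forms 4 → Root -[1+ m ] -[1+ m ] (+ 0) t w
steep-root residue factors {a} u≡ (inj₁ a≡) (inj₁ refl) (here refl) =
  gaussian (subst (_∈ gaussian-roots) (sym (recover (two-three 0 residue) factors (+ 1 , + 1) (+ 3 , - + 5) (+ 2 , - + 2) (+ 1 , - + 3)
    (trans u≡ (cong (_, + 1) (odd-injective a (+ 1) (+-cancel-0 a≡) refl))) refl refl refl)) (here refl))
steep-root residue factors {a} u≡ (inj₁ a≡) (inj₂ refl) (here refl) =
  gaussian (subst (_∈ gaussian-roots) (sym (recover (two-three 0 residue) factors (+ 1 , - + 1) (+ 3 , + 5) (+ 2 , + 2) (+ 1 , + 3)
    (trans u≡ (cong (_, - + 1) (odd-injective a (+ 1) (+-cancel-0 a≡) refl))) refl refl refl)) (there (here refl)))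
steep-root residue factors {a} u≡ (inj₂ a≡) (inj₁ refl) (here refl) =
  gaussian (subst (_∈ gaussian-roots) (sym (recover (two-three 0 residue) factors (+ 0 , + 1) (- + 2 , - + 5) (- + 1 , - + 2) (- + 1 , - + 3)
    (trans u≡ (cong (_, + 1) (odd-injective a (+ 0) (+-cancel-0 a≡) refl))) refl refl refl)) (there (there (here refl))))
steep-root residue factors {a} u≡ (inj₂ a≡) (inj₂ refl) (here refl) =
  gaussian (subst (_∈ gaussian-roots) (sym (recover (two-three 0 residue) factors (+ 0 , - + 1) (- + 2 , + 5) (- + 1 , + 2) (- + 1 , + 3)
    (trans u≡ (cong (_, - + 1) (odd-injective a (+ 0) (+-cancel-0 a≡) refl))) refl refl refl)) (there (there (there (here refl)))))
steep-root residue factors {a} u≡ (inj₁ a≡) (inj₁ refl) (there (here refl)) =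
  ℚ√-6 (subst (_∈ ℚ√-6-roots) (sym (recover (two-three 5 residue) factors (+ 1 , + 1) (+ 1 , - + 1) (+ 1 , + 0) (+ 0 , - + 1)
    (trans u≡ (cong (_, + 1) (odd-injective a (+ 1) (+-cancel-0 a≡) refl))) refl refl refl)) (here refl))
steep-root residue factors {a} u≡ (inj₁ a≡) (inj₂ refl) (there (here refl)) =
  ℚ√-6 (subst (_∈ ℚ√-6-roots) (sym (recover (two-three 5 residue) factors (+ 1 , - + 1) (+ 1 , + 1) (+ 1 , + 0) (+ 0 , + 1)
    (trans u≡ (cong (_, - + 1) (odd-injective a (+ 1) (+-cancel-0 a≡) refl))) refl refl refl)) (there (here refl)))
steep-root residue factors {a} u≡ (inj₂ a≡) (inj₁ refl) (there (here refl)) =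
  ℚ√-6 (subst (_∈ ℚ√-6-roots) (sym (recover (two-three 5 residue) factors (+ 0 , + 1) (+ 0 , - + 1) (+ 0 , + 0) (+ 0 , - + 1)
    (trans u≡ (cong (_, + 1) (odd-injective a (+ 0) (+-cancel-0 a≡) refl))) refl refl refl)) (there (there (here refl))))
steep-root residue factors {a} u≡ (inj₂ a≡) (inj₂ refl) (there (here refl)) =
  ℚ√-6 (subst (_∈ ℚ√-6-roots) (sym (recover (two-three 5 residue) factors (+ 0 , - + 1) (+ 0 , + 1) (+ 0 , + 0) (+ 0 , + 1)
    (trans u≡ (cong (_, - + 1) (odd-injective a (+ 0) (+-cancel-0 a≡) refl))) refl refl refl)) (there (there (there (here refl)))))
steep-root residue factors {a} u≡ (inj₁ a≡) (inj₁ refl) (there (there (there (here refl)))) =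
  gaussian (subst (_∈ gaussian-roots) (sym (recover (two-three 0 residue) factors (+ 2 , + 2) (+ 2 , - + 2) (+ 2 , + 0) (+ 0 , - + 2)
    (trans u≡ (cong (_, + 2) (odd-injective a (+ 2) (+-cancel-0 a≡) refl))) refl refl refl)) (there (there (there (there (here refl))))))
steep-root residue factors {a} u≡ (inj₁ a≡) (inj₂ refl) (there (there (there (here refl)))) =
  gaussian (subst (_∈ gaussian-roots) (sym (recover (two-three 0 residue) factors (+ 2 , - + 2) (+ 2 , + 2) (+ 2 , + 0) (+ 0 , + 2)
    (trans u≡ (cong (_, - + 2) (odd-injective a (+ 2) (+-cancel-0 a≡) refl))) refl refl refl)) (there (there (there (there (there (here refl)))))))
steep-root residue factors {a} u≡ (inj₂ a≡) (inj₁ refl) (there (there (there (here refl)))) =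
  gaussian (subst (_∈ gaussian-roots) (sym (recover (two-three 0 residue) factors (- + 1 , + 2) (- + 1 , - + 2) (- + 1 , + 0) (+ 0 , - + 2)
    (trans u≡ (cong (_, + 2) (odd-injective a (- + 1) (+-cancel-0 a≡) refl))) refl refl refl)) (there (there (there (there (there (there (here refl))))))))
steep-root residue factors {a} u≡ (inj₂ a≡) (inj₂ refl) (there (there (there (here refl)))) =
  gaussian (subst (_∈ gaussian-roots) (sym (recover (two-three 0 residue) factors (- + 1 , - + 2) (- + 1 , + 2) (- + 1 , + 0) (+ 0 , + 2)
    (trans u≡ (cong (_, - + 2) (odd-injective a (- + 1) (+-cancel-0 a≡) refl))) refl refl refl)) (there (there (there (there (there (there (there (here refl)))))))))
-- The form 9 + 16 belongs to D = -4, which is 0 modulo 4 and so has no `Residue`.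
steep-root (two k eq) _ _ _ _ (there (there (here refl))) = ⊥-elim (indivisible {+ 4} {k = - + 6} (residue k eq))
  where
  residue : ∀ k → - + 4 ≡ + 2 + + 4 * k → + 4 * k ≡ - + 6
  residue k eq = shift (sym eq) (lemma k)
    where
    lemma : ∀ k → + 4 * k ≡ - + 6 + (+ 2 + + 4 * k - - + 4)
    lemma = solve-∀
steep-root (three k eq) _ _ _ _ (there (there (here refl))) = ⊥-elim (indivisible {+ 4} {k = - + 7} (residue k eq))
  where
  residue : ∀ k → - + 4 ≡ + 3 + + 4 * k → + 4 * k ≡ - + 7
  residue k eq = shift (sym eq) (lemma k)
    where
    lemma : ∀ k → + 4 * k ≡ - + 7 + (+ 3 + + 4 * k - - + 4)
    lemma = solve-∀

root : ∀ {D p q} (M : Maximal D p q) {t w} → let open Order p q in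
  odd (t ⊖ w) · odd (t ⊕ w) ≡ int (+ 25) → ∀ u → t ⊖ w ≡ u → Small (size M u) → Root D p q t w
root M factors (a , + 0) u≡ small =
  flat-root M factors u≡ (abs-cases (+ 2 * a + - + 1 + + 0) refl) (flat M small)
  where
  flat : ∀ {D p q} (M : Maximal D p q) → Small (size M (a , + 0)) → ∣ + 2 * a + - + 1 + + 0 ∣ ∈ flat-values
  flat (one m) = flat-forms 3 (∣ + 2 * a + - + 1 + + 0 ∣) m
  flat (two-three m _) = flat-forms 4 (∣ + 2 * a + - + 1 + + 0 ∣) m
root (one m) factors (a , + suc b) u≡ small = ⊥-elim (¬Any[] (steep-forms-3 (∣ + 2 * a + - + 1 + + suc b * + 1 ∣) b m small))
root (one m) factors (a , -[1+ b ]) u≡ small = ⊥-elim (¬Any[] (steep-forms-3 (∣ + 2 * a + - + 1 + -[1+ b ] * + 1 ∣) b m small))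
root (two-three m residue) factors (a , b@(+ suc n)) u≡ small = steep-root residue factors u≡
  (abs-cases (+ 2 * a + - + 1 + + 0) refl) (inj₁ refl)
  -- `size` contains the term b q with q = 0, which does not reduce on its own.
  (steep-forms-4 (∣ + 2 * a + - + 1 + + 0 ∣) n m (subst (λ z → Small (form 4 (∣ + 2 * a + - + 1 + z ∣) (suc n) m)) (ℤ.*-zeroʳ b) small))
root (two-three m residue) factors (a , b@(-[1+ n ])) u≡ small = steep-root residue factors u≡
  (abs-cases (+ 2 * a + - + 1 + + 0) refl) (inj₂ refl)
  (steep-forms-4 (∣ + 2 * a + - + 1 + + 0 ∣) n m (subst (λ z → Small (form 4 (∣ + 2 * a + - + 1 + z ∣) (suc n) m)) (ℤ.*-zeroʳ b) small))

-- Descent from a progression to the pair (t , w)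

small-factor : ∀ a b → a ℕ.* b ≡ 625 → Small a ⊎ Small b
small-factor a b ab≡625 with a ℕ.≤? 25 | b ℕ.≤? 25
... | yes a≤25 | _ = inj₁ (a≤25 , ℕ.divides b (trans (sym ab≡625) (ℕ.*-comm a b)))
... | no _ | yes b≤25 = inj₂ (b≤25 , ℕ.divides a (sym ab≡625))
-- Two factors above 25 have a product of at least 26 · 26 = 676 = 625 + 51.
... | no a≰25 | no b≰25 = contradiction (ℕ.*-mono-≤ (ℕ.≰⇒> a≰25) (ℕ.≰⇒> b≰25))
  (ℕ.<⇒≱ (ℕ.≤-<-trans (ℕ.≤-reflexive ab≡625) (ℕ.m<n+m 625 {51} ℕ.z<s)))

-- x² + y² + z² = δ x y z for x = y − e and z = y + e, solved for e².
Balanced : (p q : ℤ) → Pair → Pair → Pair → Set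
Balanced p q δ y e = e · e · (δ · y ⊕ int (+ 2)) ≡ y · y · (δ · y ⊕ int (- + 3))
  where open Order p q

module _ {D p q : ℤ} (M : Maximal D p q) where
  open Order p q

  int-cancel : ∀ k x y .{{_ : NonZero k}} → int k · x ≡ int k · y → x ≡ y
  int-cancel k (a , b) (c , d) eq = cong₂ _,_
    (ℤ.*-cancelˡ-≡ k a c (cong proj₁ eq′)) (ℤ.*-cancelˡ-≡ k b d (cong proj₂ eq′))
    where
    eq′ : (k * a , k * b) ≡ (k * c , k * d)
    eq′ = int-·-≡ k (a , b) (trans eq (int-· k c d))

  norm-nonZero : ∀ x → x ≢ int (+ 0) → NonZero (norm x)
  norm-nonZero x x≢0 = ≢-nonZero λ n≡0 → x≢0 (norm≡0 M x n≡0)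

  ·-cancelʳ : ∀ s x y .{{_ : NonZero (norm s)}} → x · s ≡ y · s → x ≡ y
  ·-cancelʳ s x y eq = int-cancel (norm s) x y (trans (expand x) (trans (cong (_· conj s) eq) (sym (expand y))))
    where
    expand : ∀ x → int (norm s) · x ≡ x · s · conj s
    expand x = trans (*-comm (int (norm s)) x)
      (trans (cong (x ·_) (sym (·-conj s))) (sym (*-assoc x s (conj s))))

  zeroˡ : ∀ x → int (+ 0) · x ≡ int (+ 0)
  zeroˡ (a , b) = int-· (+ 0) a b

  no-zero-divisors : ∀ x y → x · y ≡ int (+ 0) → y ≢ int (+ 0) → x ≡ int (+ 0)
  no-zero-divisors x y xy≡0 y≢0 = ·-cancelʳ y x (int (+ 0)) {{norm-nonZero y y≢0}} (trans xy≡0 (sym (zeroˡ y)))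

  -- The quotient w = e s / y is taken as e s `conj y` over the integer N(y), the shape to which
  -- `SquareRootsIntegral` applies.
  quotient-integral : SquareRootsIntegral p q → ∀ e y r s → y ≢ int (+ 0) →
    e · e · s ≡ y · y · r → ∃[ w ] (w · y ≡ e · s × w · w ≡ r · s)
  quotient-integral closed e y r s y≢0 eq = from-root (closed N X (r · s) {{N≢0}} XX≡)
    where
    N = norm y
    N≢0 = norm-nonZero y y≢0
    X = e · s · conj y
    XX≡ : X · X ≡ int (N * N) · (r · s)
    XX≡ = trans (square-of-root e y (conj y) r s eq)
      (cong (_· (r · s)) (trans (cong₂ _·_ (·-conj y) (·-conj y)) (int-·-int N N)))
    from-root : ∃[ w ] X ≡ int N · w → ∃[ w ] (w · y ≡ e · s × w · w ≡ r · s)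
    from-root (w , X≡Nw) = w , int-cancel N (w · y) (e · s) {{N≢0}} wy , int-cancel N (w · w) (r · s) {{N≢0}}
        (int-cancel N (int N · (w · w)) (int N · (r · s)) {{N≢0}} ww)
      where
      open ≡-Reasoning
      wy : int N · (w · y) ≡ int N · (e · s)
      wy = begin
        int N · (w · y)          ≡⟨ *-assoc (int N) w y ⟨
        int N · w · y            ≡⟨ cong (_· y) X≡Nw ⟨
        e · s · conj y · y       ≡⟨ *-assoc (e · s) (conj y) y ⟩
        e · s · (conj y · y)     ≡⟨ cong (e · s ·_) (trans (*-comm (conj y) y) (·-conj y)) ⟩
        e · s · int N            ≡⟨ *-comm (e · s) (int N) ⟩
        int N · (e · s)          ∎
      ww : int N · (int N · (w · w)) ≡ int N · (int N · (r · s))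
      ww = begin
        int N · (int N · (w · w))  ≡⟨ cong (int N ·_) (*-assoc (int N) w w) ⟨
        int N · (int N · w · w)    ≡⟨ cong (int N ·_) (*-comm (int N · w) w) ⟩
        int N · (w · (int N · w))  ≡⟨ *-assoc (int N) w (int N · w) ⟨
        int N · w · (int N · w)    ≡⟨ cong₂ _·_ X≡Nw X≡Nw ⟨
        X · X                      ≡⟨ XX≡ ⟩
        int (N * N) · (r · s)      ≡⟨ cong (_· (r · s)) (int-·-int N N) ⟨
        int N · int N · (r · s)    ≡⟨ *-assoc (int N) (int N) (r · s) ⟩
        int N · (int N · (r · s))  ∎

  odd≡ : ∀ u → int (+ 2) · u ⊕ int (- + 1) ≡ odd u
  odd≡ (a , b) = trans (cong (_⊕ int (- + 1)) (int-· (+ 2) a b))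
    (cong (+ 2 * a + - + 1 ,_) (ℤ.+-identityʳ (+ 2 * b)))

  root-up-to-sign : ∀ t w → w · w ≡ (t ⊕ int (- + 3)) · (t ⊕ int (+ 2)) → Root D p q t w ⊎ Root D p q t (⊝ w)
  root-up-to-sign t w ww≡ = from-sizes (small-factor (size M u) (size M v) sizes)
    where
    u = t ⊖ w
    v = t ⊕ w
    factors : odd u · odd v ≡ int (+ 25)
    factors = trans (sym (cong₂ _·_ (odd≡ u) (odd≡ v))) (factorisation t w ww≡)
    u≡ : t ⊕ ⊝ w ≡ u
    u≡ = refl
    v≡ : t ⊖ ⊝ w ≡ v
    v≡ = cong (t ⊕_) (cong₂ _,_ (ℤ.neg-involutive (proj₁ w)) (ℤ.neg-involutive (proj₂ w)))
    sizes : size M u ℕ.* size M v ≡ 625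
    sizes = ℤ.+-injective (trans (ℤ.pos-* (size M u) (size M v))
      (trans (sym (cong₂ _*_ (norm-odd M u) (norm-odd M v))) (trans (sym (norm-· (odd u) (odd v))) (cong norm factors))))
    from-sizes : Small (size M u) ⊎ Small (size M v) → Root D p q t w ⊎ Root D p q t (⊝ w)
    from-sizes (inj₁ small) = inj₁ (root M factors u refl small)
    -- Negating w exchanges the two factors.
    from-sizes (inj₂ small) = inj₂ (root M
      (trans (cong₂ _·_ (cong odd v≡) (cong odd u≡)) (trans (*-comm (odd v) (odd u)) factors)) v v≡ small)

-- e′ is e with the sign that makes the first factor small. The condition δ y ≠ -2 is kept so that
-- e′ can be recovered by cancelling δ y + 2.
data Descent (D p q : ℤ) (δ y e : Pair) : Set where
  trivial : y ≡ (+ 0 , + 0) → e ≡ (+ 0 , + 0) → Descent D p q δ y e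
  proper  : let open Order p q in
    y ≢ int (+ 0) → δ · y ≢ int (- + 2) → ∀ e′ w → e ≡ e′ ⊎ e ≡ ⊝ e′ →
    w · y ≡ e′ · (δ · y ⊕ int (+ 2)) → Root D p q (δ · y) w → Descent D p q δ y e

infix 4 _≟_

_≟_ : (x y : Pair) → Dec (x ≡ y)
_≟_ = ≡-dec ℤ._≟_ ℤ._≟_

module _ {D p q : ℤ} (M : Maximal D p q) (closed : SquareRootsIntegral p q) where
  open Order p q

  square-multiple≡0 : ∀ x k → k ≢ + 0 → x · x · int k ≡ int (+ 0) → x ≡ int (+ 0)
  square-multiple≡0 x k k≢0 xxk≡0 with x ≟ int (+ 0)
  ... | yes x≡0 = x≡0
  ... | no x≢0 = no-zero-divisors M x x (no-zero-divisors M (x · x) (int k) xxk≡0 int≢0) x≢0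
    where
    int≢0 : int k ≢ int (+ 0)
    int≢0 eq = k≢0 (cong proj₁ eq)

  descent : ∀ δ y e → Balanced p q δ y e → Descent D p q δ y e
  descent δ y e balanced = by-cases (y ≟ int (+ 0))
    where
    s = δ · y ⊕ int (+ 2)
    r = δ · y ⊕ int (- + 3)
    zeroʳ : ∀ x → x · int (+ 0) ≡ int (+ 0)
    zeroʳ x = trans (*-comm x (int (+ 0))) (zeroˡ M x)
    δ·y≢-2 : y ≢ int (+ 0) → δ · y ≢ int (- + 2)
    -- At t = -2 the balanced equation collapses to 0 = -5 y².
    δ·y≢-2 y≢0 δy≡ = y≢0 (square-multiple≡0 y (- + 5) (λ ()) (begin
      y · y · int (- + 5)  ≡⟨ cong (λ t → y · y · (t ⊕ int (- + 3))) δy≡ ⟨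
      y · y · r            ≡⟨ balanced ⟨
      e · e · s            ≡⟨ cong (λ t → e · e · (t ⊕ int (+ 2))) δy≡ ⟩
      e · e · int (+ 0)    ≡⟨ zeroʳ (e · e) ⟩
      int (+ 0)            ∎))
      where open ≡-Reasoning
    by-cases : Dec (y ≡ int (+ 0)) → Descent D p q δ y e
    by-cases (yes y≡0) = trivial y≡0 (square-multiple≡0 e (+ 2) (λ ()) (begin
      e · e · int (+ 2)                        ≡⟨ cong (λ t → e · e · (t ⊕ int (+ 2))) (zeroʳ δ) ⟨
      e · e · (δ · int (+ 0) ⊕ int (+ 2))      ≡⟨ cong (λ y → e · e · (δ · y ⊕ int (+ 2))) y≡0 ⟨
      e · e · s                                ≡⟨ balanced ⟩
      y · y · r                                ≡⟨ cong (λ y → y · y · r) y≡0 ⟩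
      int (+ 0) · int (+ 0) · r                ≡⟨ cong (_· r) (zeroˡ M (int (+ 0))) ⟩
      int (+ 0) · r                            ≡⟨ zeroˡ M r ⟩
      int (+ 0)                                ∎))
      where open ≡-Reasoning
    by-cases (no y≢0) = from-quotient (quotient-integral M closed e y r s y≢0 balanced)
      where
      negate : ∀ w → w · y ≡ e · s → ⊝ w · y ≡ ⊝ e · s
      negate w eq = trans (sym (-‿distribˡ-* ring w y)) (trans (cong ⊝_ eq) (-‿distribˡ-* ring e s))
      from-root : ∀ w → w · y ≡ e · s → Root D p q (δ · y) w ⊎ Root D p q (δ · y) (⊝ w) → Descent D p q δ y e
      from-root w wy (inj₁ root) = proper y≢0 (δ·y≢-2 y≢0) e w (inj₁ refl) wy root
      from-root w wy (inj₂ root) = proper y≢0 (δ·y≢-2 y≢0) (⊝ e) (⊝ w)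
        (inj₂ (cong₂ _,_ (sym (ℤ.neg-involutive (proj₁ e))) (sym (ℤ.neg-involutive (proj₂ e))))) (negate w wy) root
      from-quotient : ∃[ w ] (w · y ≡ e · s × w · w ≡ r · s) → Descent D p q δ y e
      from-quotient (w , wy , ww) = from-root w wy (root-up-to-sign M (δ · y) w ww)

maximal-closed : ∀ {D p q} → Squarefree D → Maximal D p q → SquareRootsIntegral p q
maximal-closed squarefree (one m) = integral-one (+ 1 + + 4 * -[1+ m ]) -[1+ m ] squarefree refl
maximal-closed squarefree (two-three m residue) = integral-two-three -[1+ m ] squarefree residue

-- Progressions in the ring of integers

module Field (D : ℤ) = Order (proj₁ (ωSq D)) (proj₂ (ωSq D))

AP-balanced : ∀ D d x y z → let open Field D in APK D d x y z →
  ∃[ e ] (x ≡ y ⊖ e × z ≡ y ⊕ e × Balanced (proj₁ (ωSq D)) (proj₂ (ωSq D)) (int (+ d)) y e)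
AP-balanced D d x@(x₁ , x₂) y@(y₁ , y₂) z@(z₁ , z₂) (arithmetic , eq) =
  e , x≡ , z≡ , progression (int (+ d)) y e (subst₂ (λ x z → x · x ⊕ y · y ⊕ z · z ≡ int (+ d) · x · y · z) x≡ z≡ eq)
  where
  open Field D
  e = z ⊖ y
  first : ∀ x y z → x ≡ y - (z - y) + (z - y - (y - x))
  first = solve-∀
  last : ∀ y z → z ≡ y + (z - y)
  last = solve-∀
  x≡ : x ≡ y ⊖ e
  x≡ = cong₂ _,_ (shift (sym (cong proj₁ arithmetic)) (first x₁ y₁ z₁)) (shift (sym (cong proj₂ arithmetic)) (first x₂ y₂ z₂))
  z≡ : z ≡ y ⊕ e
  z≡ = cong₂ _,_ (last y₁ z₁) (last y₂ z₂)

AP-descent : ∀ D d → Squarefree D → D < + 0 → ∀ x y z → let open Field D in APK D d x y z →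
  ∃[ e ] (x ≡ y ⊖ e × z ≡ y ⊕ e × Descent D (proj₁ (ωSq D)) (proj₂ (ωSq D)) (int (+ d)) y e)
AP-descent D d squarefree D<0 x y z ap = from-balanced (AP-balanced D d x y z ap)
  where
  open Field D
  M = maximal D squarefree D<0
  from-balanced : ∃[ e ] (x ≡ y ⊖ e × z ≡ y ⊕ e × Balanced (proj₁ (ωSq D)) (proj₂ (ωSq D)) (int (+ d)) y e) →
    ∃[ e ] (x ≡ y ⊖ e × z ≡ y ⊕ e × Descent D (proj₁ (ωSq D)) (proj₂ (ωSq D)) (int (+ d)) y e)
  from-balanced (e , x≡ , z≡ , balanced) = e , x≡ , z≡ , descent M (maximal-closed squarefree M) (int (+ d)) y e balanced

-- Solutions outside the exceptional pairs are rational

module _ {p q : ℤ} where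
  open Order p q

  no-imaginary-part : ∀ d τ ω σ y e .{{_ : NonZero d}} .{{_ : NonZero σ}} →
    int d · y ≡ int τ → int ω · y ≡ e · int σ → proj₂ y ≡ + 0 × proj₂ e ≡ + 0
  no-imaginary-part d τ ω σ y e dy≡τ ωy≡eσ = y₂≡0 , e₂≡0
    where
    y₂≡0 : proj₂ y ≡ + 0
    y₂≡0 = ℤ.*-cancelˡ-≡ d (proj₂ y) (+ 0) (trans (cong proj₂ (int-·-≡ d y dy≡τ)) (sym (ℤ.*-zeroʳ d)))
    e₂≡0 : proj₂ e ≡ + 0
    e₂≡0 = ℤ.*-cancelˡ-≡ σ (proj₂ e) (+ 0) (begin
      σ * proj₂ e  ≡⟨ cong proj₂ (int-·-≡ σ e (trans (*-comm (int σ) e) (sym ωy≡eσ))) ⟩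
      proj₂ (int ω · y)  ≡⟨ cong proj₂ (int-· ω (proj₁ y) (proj₂ y)) ⟩
      ω * proj₂ y  ≡⟨ cong (ω *_) y₂≡0 ⟩
      ω * + 0      ≡⟨ ℤ.*-zeroʳ ω ⟩
      + 0          ≡⟨ ℤ.*-zeroʳ σ ⟨
      σ * + 0      ∎)
      where open ≡-Reasoning

-- The case t = 1, w = ±√-6. The √-6-coordinate of w y = 3 e reads ε y₁ = 3 e₂; multiplied by ε d it
-- exhibits 1 as a multiple of 3.
ℚ√-6-absurd : ∀ d ε y e → let open Order (- + 6) (+ 0) in .{{_ : NonZero d}} →
  ε * ε ≡ + 1 → int d · y ≡ int (+ 1) → (+ 0 , ε) · y ≡ e · int (+ 3) → ⊥
ℚ√-6-absurd d ε y e εε≡1 dy≡1 wy≡3e = indivisible {+ 3} {+ 1} (begin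
  + 3 * (ε * (d * proj₂ e))             ≡⟨ rearrange d ε (proj₂ e) ⟩
  ε * d * (+ 3 * proj₂ e)               ≡⟨ cong (ε * d *_) (cong proj₂ (int-·-≡ (+ 3) e (trans (*-comm (int (+ 3)) e) (sym wy≡3e)))) ⟩
  ε * d * (+ 0 * proj₂ y + ε * proj₁ y + ε * proj₂ y * + 0)  ≡⟨ collect d ε (proj₁ y) (proj₂ y) ⟩
  ε * ε * (d * proj₁ y)                 ≡⟨ cong₂ _*_ εε≡1 (cong proj₁ (int-·-≡ d y dy≡1)) ⟩
  + 1                                   ∎)
  where
  open Order (- + 6) (+ 0)
  open ≡-Reasoning
  rearrange : ∀ d ε e → + 3 * (ε * (d * e)) ≡ ε * d * (+ 3 * e)
  rearrange = solve-∀
  collect : ∀ d ε y₁ y₂ → ε * d * (+ 0 * y₂ + ε * y₁ + ε * y₂ * + 0) ≡ ε * ε * (d * y₁)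
  collect = solve-∀

-- From d y = t, the integer d divides the real part of t; hence d ∣ 2, and only the excluded values
-- 1 and 2 are left.
gaussian-traces : All (λ (t , w) → ∣ proj₁ t ∣ ℕ.∣ 2) gaussian-roots
gaussian-traces = from-yes (all? (λ (t , w) → ∣ proj₁ t ∣ ℕ.∣? 2) gaussian-roots)

∣2⇒≡1⊎≡2 : ∀ {d} → d ℕ.∣ 2 → d ≡ 1 ⊎ d ≡ 2
∣2⇒≡1⊎≡2 {d} d∣2 with d | d∣2 | ℕ.∣⇒≤ d∣2
... | 0 | 0∣2 | _ with () ← ℕ.0∣⇒≡0 0∣2
... | 1 | _ | _ = inj₁ refl
... | 2 | _ | _ = inj₂ refl
... | suc (suc (suc _)) | _ | ℕ.s≤s (ℕ.s≤s ())

module _ {D p q : ℤ} (d : ℕ) .{{_ : NonZero (+ d)}} (≢1 : ¬ (D ≡ - + 1 × d ≡ 1)) (≢2 : ¬ (D ≡ - + 1 × d ≡ 2)) where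
  open Order p q

  root-rational : ∀ {t w} y e → int (+ d) · y ≡ t → w · y ≡ e · (t ⊕ int (+ 2)) → y ≢ int (+ 0) → t ≢ int (- + 2) →
    Maximal D p q → Root D p q t w → proj₂ y ≡ + 0 × proj₂ e ≡ + 0
  root-rational y e dy wy _ _ _ (rational (here refl)) = no-imaginary-part (+ d) (+ 7) (+ 6) (+ 9) y e dy wy
  root-rational y e dy wy _ _ _ (rational (there (here refl))) =
    no-imaginary-part (+ d) (- + 6) (- + 6) (- + 4) y e dy wy
  root-rational y e dy wy _ _ _ (rational (there (there (here refl)))) =
    no-imaginary-part (+ d) (+ 3) (+ 0) (+ 5) y e dy wy
  root-rational y e dy wy _ t≢-2 _ (rational (there (there (there (here refl))))) = contradiction refl t≢-2
  root-rational {t} y e dy wy _ _ _ (gaussian t∈) = ⊥-elim (excluded (∣2⇒≡1⊎≡2 (ℕ.∣-trans d∣t (lookup gaussian-traces t∈))))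
    where
    d∣t : d ℕ.∣ ∣ proj₁ t ∣
    d∣t = subst (d ℕ.∣_) (trans (sym (ℤ.abs-* (+ d) (proj₁ y))) (cong (λ z → ∣ proj₁ z ∣) (int-·-≡ (+ d) y dy)))
      (ℕ.m∣m*n (∣ proj₁ y ∣))
    excluded : d ≡ 1 ⊎ d ≡ 2 → ⊥
    excluded (inj₁ d≡1) = ≢1 (refl , d≡1)
    excluded (inj₂ d≡2) = ≢2 (refl , d≡2)
  root-rational y e dy wy _ _ _ (ℚ√-6 (here refl)) = ⊥-elim (ℚ√-6-absurd (+ d) (- + 1) y e refl dy wy)
  root-rational y e dy wy _ _ _ (ℚ√-6 (there (here refl))) = ⊥-elim (ℚ√-6-absurd (+ d) (+ 1) y e refl dy wy)
  -- The remaining pairs over ℚ(√-6) have t = d y = 0, against y ≠ 0.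
  root-rational y e dy wy y≢0 _ M (ℚ√-6 (there (there (here refl)))) = contradiction
    (int-cancel M (+ d) y (int (+ 0)) (trans dy (sym (trans (*-comm (int (+ d)) (int (+ 0))) (zeroˡ M (int (+ d))))))) y≢0
  root-rational y e dy wy y≢0 _ M (ℚ√-6 (there (there (there (here refl))))) = contradiction
    (int-cancel M (+ d) y (int (+ 0)) (trans dy (sym (trans (*-comm (int (+ d)) (int (+ 0))) (zeroˡ M (int (+ d))))))) y≢0

  descent-rational : ∀ y e → Maximal D p q → Descent D p q (int (+ d)) y e → proj₂ y ≡ + 0 × proj₂ e ≡ + 0
  descent-rational y e M (trivial y≡0 e≡0) = cong proj₂ y≡0 , cong proj₂ e≡0
  descent-rational y e M (proper y≢0 t≢-2 e′ w e≡±e′ wy root) =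
    from-sign e≡±e′ (root-rational y e′ refl wy y≢0 t≢-2 M root)
    where
    from-sign : e ≡ e′ ⊎ e ≡ ⊝ e′ → proj₂ y ≡ + 0 × proj₂ e′ ≡ + 0 → proj₂ y ≡ + 0 × proj₂ e ≡ + 0
    from-sign (inj₁ refl) y₂,e₂ = y₂,e₂
    from-sign (inj₂ refl) (y₂≡0 , e′₂≡0) = y₂≡0 , cong -_ e′₂≡0

module _ (D : ℤ) (d : ℕ) where
  open Field D

  private
    squares-int : ∀ a b c → int a · int a ⊕ int b · int b ⊕ int c · int c ≡ int (a * a + b * b + c * c)
    squares-int a b c = cong₂ _⊕_ (cong₂ _⊕_ (int-·-int a a) (int-·-int b b)) (int-·-int c c)

    product-int : ∀ a b c → int (+ d) · int a · int b · int c ≡ int (+ d * a * b * c)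
    product-int a b c = trans (cong (λ u → u · int b · int c) (int-·-int (+ d) a))
      (trans (cong (_· int c) (int-·-int (+ d * a) b)) (int-·-int (+ d * a * b) c))

  APK-int⇒APℚ : ∀ a b c → APK D d (ι D a) (ι D b) (ι D c) → APℚ d a b c
  APK-int⇒APℚ a b c (arithmetic , eq) =
    cong proj₁ arithmetic , cong proj₁ (trans (sym (squares-int a b c)) (trans eq (product-int a b c)))

  APℚ⇒APK-int : ∀ a b c → APℚ d a b c → APK D d (ι D a) (ι D b) (ι D c)
  APℚ⇒APK-int a b c (arithmetic , eq) =
    cong (_, + 0) arithmetic , trans (squares-int a b c) (trans (cong int eq) (sym (product-int a b c)))

  AP-rational : Squarefree D → D < + 0 → 1 ℕ.≤ d → ¬ (D ≡ - + 1 × d ≡ 1) → ¬ (D ≡ - + 1 × d ≡ 2) → ∀ x y z →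
    APK D d x y z ⇔ (∃[ a ] ∃[ b ] ∃[ c ] (APℚ d a b c × x ≡ ι D a × y ≡ ι D b × z ≡ ι D c))
  AP-rational squarefree D<0 1≤d ≢1 ≢2 x y z = mk⇔ forward
    (λ { (a , b , c , ap , refl , refl , refl) → APℚ⇒APK-int a b c ap })
    where
    instance _ = ≢-nonZero {+ d} λ { refl → ℕ.<⇒≢ 1≤d refl }
    M = maximal D squarefree D<0
    Conclusion = ∃[ a ] ∃[ b ] ∃[ c ] (APℚ d a b c × x ≡ ι D a × y ≡ ι D b × z ≡ ι D c)
    real : ∀ {x : Pair} → proj₂ x ≡ + 0 → x ≡ ι D (proj₁ x)
    real {x} x₂≡0 = cong (proj₁ x ,_) x₂≡0
    forward : APK D d x y z → Conclusion
    forward ap = from-descent (AP-descent D d squarefree D<0 x y z ap)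
      where
      from-descent : ∃[ e ] (x ≡ y ⊖ e × z ≡ y ⊕ e × Descent D (proj₁ (ωSq D)) (proj₂ (ωSq D)) (int (+ d)) y e) → Conclusion
      from-descent (e , x≡ , z≡ , desc) = from-real (descent-rational d ≢1 ≢2 y e M desc)
        where
        from-real : proj₂ y ≡ + 0 × proj₂ e ≡ + 0 → Conclusion
        from-real (y₂≡0 , e₂≡0) = proj₁ x , proj₁ y , proj₁ z ,
          APK-int⇒APℚ (proj₁ x) (proj₁ y) (proj₁ z)
            (subst (λ x → APK D d x (ι D (proj₁ y)) (ι D (proj₁ z))) x-real
              (subst (λ y → APK D d x y (ι D (proj₁ z))) y-real (subst (λ z → APK D d x y z) z-real ap))) ,
          x-real , y-real , z-real
          where
          x-real = real (trans (cong proj₂ x≡) (cong₂ _-_ y₂≡0 e₂≡0))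
          y-real = real y₂≡0
          z-real = real (trans (cong proj₂ z≡) (cong₂ _+_ y₂≡0 e₂≡0))

-- The Gaussian integers with d = 1 and d = 2

module Gaussian = Field (- + 1)
open Gaussian

ℤ[i] : Maximal (- + 1) (- + 1) (+ 0)
ℤ[i] = two-three 0 (three (- + 1) refl)

module _ (d : ℤ) (t w y e : Pair) .{{_ : NonZero d}}
  (δy≡t : int d · y ≡ t) (wy≡es : w · y ≡ e · (t ⊕ int (+ 2))) where

  components : (d * proj₁ y , d * proj₂ y) ≡ t
  components = int-·-≡ d y δy≡t

  -- Serves to discard a root: when s = t + 2 is an integer, it must divide both coordinates of w Y
  -- with Y = t / d.
  numerator : ∀ s Y → t ≡ int d · Y → t ⊕ int (+ 2) ≡ int s → (s * proj₁ e , s * proj₂ e) ≡ w · Y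
  numerator s Y t≡δY t+2≡s = begin
    (s * proj₁ e , s * proj₂ e)  ≡⟨ int-· s (proj₁ e) (proj₂ e) ⟨
    int s · e                    ≡⟨ *-comm (int s) e ⟩
    e · int s                    ≡⟨ cong (e ·_) t+2≡s ⟨
    e · (t ⊕ int (+ 2))          ≡⟨ wy≡es ⟨
    w · y                        ≡⟨ cong (w ·_) (int-cancel ℤ[i] d y Y (trans δy≡t t≡δY)) ⟩
    w · Y                        ∎
    where open ≡-Reasoning

  -- Since d and t + 2 can be cancelled, t and w admit at most one pair (y , e); a numerical
  -- candidate is verified by `refl`.
  locate : ∀ Y E .{{_ : NonZero (norm (t ⊕ int (+ 2)))}} → t ≡ int d · Y → w · Y ≡ E · (t ⊕ int (+ 2)) →
    (y , e) ≡ (Y , E)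
  locate Y E t≡δY wY≡Es = cong₂ _,_ y≡Y
    (·-cancelʳ ℤ[i] (t ⊕ int (+ 2)) e E (trans (sym wy≡es) (trans (cong (w ·_) y≡Y) wY≡Es)))
    where
    y≡Y = int-cancel ℤ[i] d y Y (trans δy≡t t≡δY)

-- Middle terms with common differences, the latter up to sign.
steps-1 steps-2 : List (Pair × Pair)
steps-1 =
    ((- + 6 , + 0) , (- + 9 , + 0))
  ∷ ((+ 3 , + 0) , (+ 0 , + 0))
  ∷ ((+ 2 , - + 2) , (+ 0 , - + 2))
  ∷ ((+ 2 , + 2) , (+ 0 , + 2))
  ∷ ((- + 1 , - + 2) , (- + 3 , - + 1))
  ∷ ((- + 1 , + 2) , (- + 3 , + 1))
  ∷ ((+ 2 , + 0) , (+ 0 , - + 1))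
  ∷ ((+ 2 , + 0) , (+ 0 , + 1))
  ∷ ((- + 1 , + 0) , (+ 0 , + 2))
  ∷ ((- + 1 , + 0) , (+ 0 , - + 2))
  ∷ []
steps-2 =
    ((+ 1 , - + 1) , (+ 0 , - + 1))
  ∷ ((+ 1 , + 1) , (+ 0 , + 1))
  ∷ []

step-1 : ∀ {t w y e} → int (+ 1) · y ≡ t → w · y ≡ e · (t ⊕ int (+ 2)) → t ≢ int (- + 2) →
  Root (- + 1) (- + 1) (+ 0) t w → (y , e) ∈ steps-1
step-1 {t} {w} {y} {e} δy≡t wy≡es _ (rational (here refl)) =
  -- At t = 7, w = 6 the equation is 9 e = 6 · 7.
  ⊥-elim (indivisible {m = + 9} {+ 42}
  (cong proj₁ (numerator (+ 1) t w y e δy≡t wy≡es (+ 9) (+ 7 , + 0) refl refl)))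
step-1 {t} {w} {y} {e} δy≡t wy≡es _ (rational (there (here refl))) =
  subst (_∈ steps-1) (sym (locate (+ 1) t w y e δy≡t wy≡es (- + 6 , + 0) (- + 9 , + 0) refl refl))
    (here refl)
step-1 {t} {w} {y} {e} δy≡t wy≡es _ (rational (there (there (here refl)))) =
  subst (_∈ steps-1) (sym (locate (+ 1) t w y e δy≡t wy≡es (+ 3 , + 0) (+ 0 , + 0) refl refl))
    (there (here refl))
step-1 {t} {w} {y} {e} δy≡t wy≡es t≢-2 (rational (there (there (there (here refl))))) = contradiction refl t≢-2
step-1 {t} {w} {y} {e} δy≡t wy≡es _ (gaussian (here refl)) =
  subst (_∈ steps-1) (sym (locate (+ 1) t w y e δy≡t wy≡es (+ 2 , - + 2) (+ 0 , - + 2) refl refl))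
    (there (there (here refl)))
step-1 {t} {w} {y} {e} δy≡t wy≡es _ (gaussian (there (here refl))) =
  subst (_∈ steps-1) (sym (locate (+ 1) t w y e δy≡t wy≡es (+ 2 , + 2) (+ 0 , + 2) refl refl))
    (there (there (there (here refl))))
step-1 {t} {w} {y} {e} δy≡t wy≡es _ (gaussian (there (there (here refl)))) =
  subst (_∈ steps-1) (sym (locate (+ 1) t w y e δy≡t wy≡es (- + 1 , - + 2) (- + 3 , - + 1) refl refl))
    (there (there (there (there (here refl)))))
step-1 {t} {w} {y} {e} δy≡t wy≡es _ (gaussian (there (there (there (here refl))))) =
  subst (_∈ steps-1) (sym (locate (+ 1) t w y e δy≡t wy≡es (- + 1 , + 2) (- + 3 , + 1) refl refl))
    (there (there (there (there (there (here refl))))))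
step-1 {t} {w} {y} {e} δy≡t wy≡es _ (gaussian (there (there (there (there (here refl)))))) =
  subst (_∈ steps-1) (sym (locate (+ 1) t w y e δy≡t wy≡es (+ 2 , + 0) (+ 0 , - + 1) refl refl))
    (there (there (there (there (there (there (here refl)))))))
step-1 {t} {w} {y} {e} δy≡t wy≡es _ (gaussian (there (there (there (there (there (here refl))))))) =
  subst (_∈ steps-1) (sym (locate (+ 1) t w y e δy≡t wy≡es (+ 2 , + 0) (+ 0 , + 1) refl refl))
    (there (there (there (there (there (there (there (here refl))))))))
step-1 {t} {w} {y} {e} δy≡t wy≡es _ (gaussian (there (there (there (there (there (there (here refl)))))))) =
  subst (_∈ steps-1) (sym (locate (+ 1) t w y e δy≡t wy≡es (- + 1 , + 0) (+ 0 , + 2) refl refl))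
    (there (there (there (there (there (there (there (there (here refl)))))))))
step-1 {t} {w} {y} {e} δy≡t wy≡es _ (gaussian (there (there (there (there (there (there (there (here refl))))))))) =
  subst (_∈ steps-1) (sym (locate (+ 1) t w y e δy≡t wy≡es (- + 1 , + 0) (+ 0 , - + 2) refl refl))
    (there (there (there (there (there (there (there (there (there (here refl))))))))))

step-2 : ∀ {t w y e} → int (+ 2) · y ≡ t → w · y ≡ e · (t ⊕ int (+ 2)) → t ≢ int (- + 2) →
  Root (- + 1) (- + 1) (+ 0) t w → (y , e) ∈ steps-2
step-2 {t} {w} {y} {e} δy≡t wy≡es _ (rational (here refl)) =
  ⊥-elim (indivisible {+ 2} {+ 7} (cong proj₁ (components (+ 2) t w y e δy≡t wy≡es)))
step-2 {t} {w} {y} {e} δy≡t wy≡es _ (rational (there (here refl))) =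
  -- Here y = -3 is integral, but -4 e = (-6)(-3) is not solvable.
  ⊥-elim (indivisible {m = - + 4} {+ 18}
  (cong proj₁ (numerator (+ 2) t w y e δy≡t wy≡es (- + 4) (- + 3 , + 0) refl refl)))
step-2 {t} {w} {y} {e} δy≡t wy≡es _ (rational (there (there (here refl)))) =
  ⊥-elim (indivisible {+ 2} {+ 3} (cong proj₁ (components (+ 2) t w y e δy≡t wy≡es)))
step-2 {t} {w} {y} {e} δy≡t wy≡es t≢-2 (rational (there (there (there (here refl))))) = contradiction refl t≢-2
step-2 {t} {w} {y} {e} δy≡t wy≡es _ (gaussian (here refl)) =
  subst (_∈ steps-2) (sym (locate (+ 2) t w y e δy≡t wy≡es (+ 1 , - + 1) (+ 0 , - + 1) refl refl))
    (here refl)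
step-2 {t} {w} {y} {e} δy≡t wy≡es _ (gaussian (there (here refl))) =
  subst (_∈ steps-2) (sym (locate (+ 2) t w y e δy≡t wy≡es (+ 1 , + 1) (+ 0 , + 1) refl refl))
    (there (here refl))
step-2 {t} {w} {y} {e} δy≡t wy≡es _ (gaussian (there (there (here refl)))) =
  ⊥-elim (indivisible {+ 2} {k = - + 1} (cong proj₁ (components (+ 2) t w y e δy≡t wy≡es)))
step-2 {t} {w} {y} {e} δy≡t wy≡es _ (gaussian (there (there (there (here refl))))) =
  ⊥-elim (indivisible {+ 2} {k = - + 1} (cong proj₁ (components (+ 2) t w y e δy≡t wy≡es)))
step-2 {t} {w} {y} {e} δy≡t wy≡es _ (gaussian (there (there (there (there (here refl)))))) =
  ⊥-elim (indivisible {m = + 4} {k = - + 2}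
  (cong proj₂ (numerator (+ 2) t w y e δy≡t wy≡es (+ 4) (+ 1 , + 0) refl refl)))
step-2 {t} {w} {y} {e} δy≡t wy≡es _ (gaussian (there (there (there (there (there (here refl))))))) =
  ⊥-elim (indivisible {m = + 4} {+ 2}
  (cong proj₂ (numerator (+ 2) t w y e δy≡t wy≡es (+ 4) (+ 1 , + 0) refl refl)))
step-2 {t} {w} {y} {e} δy≡t wy≡es _ (gaussian (there (there (there (there (there (there (here refl)))))))) =
  ⊥-elim (indivisible {+ 2} {k = - + 1} (cong proj₁ (components (+ 2) t w y e δy≡t wy≡es)))
step-2 {t} {w} {y} {e} δy≡t wy≡es _ (gaussian (there (there (there (there (there (there (there (here refl))))))))) =
  ⊥-elim (indivisible {+ 2} {k = - + 1} (cong proj₁ (components (+ 2) t w y e δy≡t wy≡es)))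

Triple : Set
Triple = Pair × Pair × Pair

triples-1 triples-2 : List Triple
triples-1 =
    (g (+ 0) (+ 0) , g (+ 0) (+ 0) , g (+ 0) (+ 0))
  ∷ (g (+ 3) (+ 0) , g (+ 3) (+ 0) , g (+ 3) (+ 0))
  ∷ (g (- + 15) (+ 0) , g (- + 6) (+ 0) , g (+ 3) (+ 0))
  ∷ (g (+ 3) (+ 0) , g (- + 6) (+ 0) , g (- + 15) (+ 0))
  ∷ (g (+ 2) (+ 0) , g (+ 2) (+ 2) , g (+ 2) (+ 4))
  ∷ (g (+ 2) (+ 0) , g (+ 2) (- + 2) , g (+ 2) (- + 4))
  ∷ (g (+ 2) (+ 1) , g (+ 2) (+ 0) , g (+ 2) (- + 1))
  ∷ (g (+ 2) (- + 1) , g (+ 2) (+ 0) , g (+ 2) (+ 1))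
  ∷ (g (+ 2) (+ 1) , g (- + 1) (+ 2) , g (- + 4) (+ 3))
  ∷ (g (+ 2) (- + 1) , g (- + 1) (- + 2) , g (- + 4) (- + 3))
  ∷ (g (- + 1) (+ 2) , g (- + 1) (+ 0) , g (- + 1) (- + 2))
  ∷ (g (- + 1) (- + 2) , g (- + 1) (+ 0) , g (- + 1) (+ 2))
  ∷ (g (+ 2) (+ 4) , g (+ 2) (+ 2) , g (+ 2) (+ 0))
  ∷ (g (+ 2) (- + 4) , g (+ 2) (- + 2) , g (+ 2) (+ 0))
  ∷ (g (- + 4) (+ 3) , g (- + 1) (+ 2) , g (+ 2) (+ 1))
  ∷ (g (- + 4) (- + 3) , g (- + 1) (- + 2) , g (+ 2) (- + 1))
  ∷ []
triples-2 =
    (g (+ 0) (+ 0) , g (+ 0) (+ 0) , g (+ 0) (+ 0))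
  ∷ (g (+ 1) (+ 2) , g (+ 1) (+ 1) , g (+ 1) (+ 0))
  ∷ (g (+ 1) (- + 2) , g (+ 1) (- + 1) , g (+ 1) (+ 0))
  ∷ (g (+ 1) (+ 0) , g (+ 1) (+ 1) , g (+ 1) (+ 2))
  ∷ (g (+ 1) (+ 0) , g (+ 1) (- + 1) , g (+ 1) (- + 2))
  ∷ []

infix 4 _∈?_

_∈?_ : (τ : Triple) (τs : List Triple) → Dec (τ ∈ τs)
_∈?_ = DecMembership._∈?_ (≡-dec _≟_ (≡-dec _≟_ _≟_))

IsAP : ℕ → Triple → Set
IsAP d (x , y , z) = APK (- + 1) d x y z

isAP? : ∀ d τ → Dec (IsAP d τ)
isAP? d (x , y , z) = (y ⊖ x ≟ z ⊖ y) ×-dec (x · x ⊕ y · y ⊕ z · z ≟ int (+ d) · x · y · z)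

-- The steps record e only up to sign, so both orientations of the progression must be listed.
Extends : List Triple → Pair × Pair → Set
Extends τs (y , e) = (y ⊖ e , y , y ⊕ e) ∈ τs × (y ⊖ ⊝ e , y , y ⊕ ⊝ e) ∈ τs

extends? : ∀ τs s → Dec (Extends τs s)
extends? τs (y , e) = (y ⊖ e , y , y ⊕ e) ∈? τs ×-dec (y ⊖ ⊝ e , y , y ⊕ ⊝ e) ∈? τs

gaussian-AP : ∀ d τs (steps : List (Pair × Pair)) →
  (∀ {t w y e} → int (+ d) · y ≡ t → w · y ≡ e · (t ⊕ int (+ 2)) → t ≢ int (- + 2) →
    Root (- + 1) (- + 1) (+ 0) t w → (y , e) ∈ steps) →
  (int (+ 0) , int (+ 0) , int (+ 0)) ∈ τs → All (Extends τs) steps → All (IsAP d) τs →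
  ∀ x y z → APK (- + 1) d x y z ⇔ (x , y , z) ∈ τs
gaussian-AP d τs steps step zero∈ extends aps x y z = mk⇔ forward (lookup aps)
  where
  proceed : ∀ {x z} e → x ≡ y ⊖ e → z ≡ y ⊕ e → Descent (- + 1) (- + 1) (+ 0) (int (+ d)) y e → (x , y , z) ∈ τs
  proceed _ refl refl (trivial refl refl) = zero∈
  proceed e refl refl (proper _ δy≢-2 e′ w (inj₁ refl) wy root) = proj₁ (lookup extends (step refl wy δy≢-2 root))
  proceed e refl refl (proper _ δy≢-2 e′ w (inj₂ refl) wy root) = proj₂ (lookup extends (step refl wy δy≢-2 root))
  forward : APK (- + 1) d x y z → (x , y , z) ∈ τs
  -- `Squarefree` sees only the absolute value, so the proof for 1 also serves for -1.
  forward ap = finish (AP-descent (- + 1) d squarefree-1 -<+ x y z ap)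
    where
    finish : ∃[ e ] (x ≡ y ⊖ e × z ≡ y ⊕ e × Descent (- + 1) (- + 1) (+ 0) (int (+ d)) y e) → (x , y , z) ∈ τs
    finish (e , x≡ , z≡ , desc) = proceed e x≡ z≡ desc

gaussian-AP-1 : ∀ x y z → APK (- + 1) 1 x y z ⇔ (x , y , z) ∈ triples-1
gaussian-AP-1 = gaussian-AP 1 triples-1 steps-1 step-1 (here refl)
  (from-yes (all? (extends? triples-1) steps-1)) (from-yes (all? (isAP? 1) triples-1))

gaussian-AP-2 : ∀ x y z → APK (- + 1) 2 x y z ⇔ (x , y , z) ∈ triples-2
gaussian-AP-2 = gaussian-AP 2 triples-2 steps-2 step-2 (here refl)
  (from-yes (all? (extends? triples-2) steps-2)) (from-yes (all? (isAP? 2) triples-2))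

theorem4 :
  ((x y z : O (- + 1)) → APK (- + 1) 1 x y z ⇔ ((x , y , z) ∈
      ( (g (+ 0) (+ 0) , g (+ 0) (+ 0) , g (+ 0) (+ 0))
      ∷ (g (+ 3) (+ 0) , g (+ 3) (+ 0) , g (+ 3) (+ 0))
      ∷ (g (- + 15) (+ 0) , g (- + 6) (+ 0) , g (+ 3) (+ 0))
      ∷ (g (+ 3) (+ 0) , g (- + 6) (+ 0) , g (- + 15) (+ 0))
      ∷ (g (+ 2) (+ 0) , g (+ 2) (+ 2) , g (+ 2) (+ 4))
      ∷ (g (+ 2) (+ 0) , g (+ 2) (- + 2) , g (+ 2) (- + 4))
      ∷ (g (+ 2) (+ 1) , g (+ 2) (+ 0) , g (+ 2) (- + 1))
      ∷ (g (+ 2) (- + 1) , g (+ 2) (+ 0) , g (+ 2) (+ 1))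
      ∷ (g (+ 2) (+ 1) , g (- + 1) (+ 2) , g (- + 4) (+ 3))
      ∷ (g (+ 2) (- + 1) , g (- + 1) (- + 2) , g (- + 4) (- + 3))
      ∷ (g (- + 1) (+ 2) , g (- + 1) (+ 0) , g (- + 1) (- + 2))
      ∷ (g (- + 1) (- + 2) , g (- + 1) (+ 0) , g (- + 1) (+ 2))
      ∷ (g (+ 2) (+ 4) , g (+ 2) (+ 2) , g (+ 2) (+ 0))
      ∷ (g (+ 2) (- + 4) , g (+ 2) (- + 2) , g (+ 2) (+ 0))
      ∷ (g (- + 4) (+ 3) , g (- + 1) (+ 2) , g (+ 2) (+ 1))
      ∷ (g (- + 4) (- + 3) , g (- + 1) (- + 2) , g (+ 2) (- + 1))
      ∷ [])))
  ×
  ((x y z : O (- + 1)) → APK (- + 1) 2 x y z ⇔ ((x , y , z) ∈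
      ( (g (+ 0) (+ 0) , g (+ 0) (+ 0) , g (+ 0) (+ 0))
      ∷ (g (+ 1) (+ 2) , g (+ 1) (+ 1) , g (+ 1) (+ 0))
      ∷ (g (+ 1) (- + 2) , g (+ 1) (- + 1) , g (+ 1) (+ 0))
      ∷ (g (+ 1) (+ 0) , g (+ 1) (+ 1) , g (+ 1) (+ 2))
      ∷ (g (+ 1) (+ 0) , g (+ 1) (- + 1) , g (+ 1) (- + 2))
      ∷ [])))
  ×
  ((D : ℤ) (d : ℕ) → Squarefree D → D < + 0 → 1 ≤ d →
    ¬ (D ≡ - + 1 × d ≡ 1) → ¬ (D ≡ - + 1 × d ≡ 2) →
    (x y z : O D) →
    APK D d x y z ⇔
      (∃[ a ] ∃[ b ] ∃[ c ] (APℚ d a b c × x ≡ ι D a × y ≡ ι D b × z ≡ ι D c)))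
theorem4 = gaussian-AP-1 , gaussian-AP-2 , AP-rational
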